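{- Let $a\in\mathbb{N}=\{1,2,\ldots\}$, let $m\ge1$ be an integer, and let $0\le\alpha_1\le\alpha_2\le\cdots\le\alpha_m$ be real numbers such that $$\big([a,\alpha_m)\cap\mathbb{N}\big)\subset\{\alpha_1,\alpha_2,\ldots,\alpha_m\}.$$ Then the sequence $$\left(\frac{(a)_k}{k!}(k+\alpha_1)(k+\alpha_2)\cdots(k+\alpha_m)\right)_{k=0}^{\infty}$$ is totally positive.
   Context: $(a)_k=a(a+1)\cdots(a+k-1)$, $(a)_0=1$, is the Pochhammer symbol. A real sequence $(a_k)_{k=0}^\infty$ is called totally positive (or a Pólya frequency sequence) if all minors of the infinite upper triangular Toeplitz matrix $\|a_{j-i}\|_{i,j\ge0}$ (with $a_k=0$ for $k<0$) are nonnegative. -}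

module Defs where

open import Algebra.Bundles using (RawRing)
import Algebra.Definitions.RawMonoid as RawMonoidDefinitions
import Algebra.Definitions.RawSemiring as RawSemiringDefinitions
open import Data.Fin.Base as Fin using (Fin; toℕ; punchIn)
open import Data.Integer.Base as ℤ using (ℤ; +_; -[1+_]; _⊖_)
open import Data.Nat.Base as ℕ using (ℕ; zero; suc; _!; _⊔_)
open import Data.Nat.Properties as ℕ using (_!≢0; m≤m⊔n; m≤n⊔m; m⊔n≤o⇒m≤o; m⊔n≤o⇒n≤o)
open import Data.Product.Base using (∃; _×_; _,_)
open import Data.Rational.Base as ℚ
  using (ℚ; 0ℚ; 1ℚ; ½; ∣_∣; 1/_; positive; nonNegative)
import Data.Rational.Properties as ℚ
open import Data.Rational.Solver using (module +-*-Solver)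
open import Data.Vec.Functional using (Vector)
open import Level using (0ℓ)
open import Relation.Binary.Core using (_Preserves_⟶_)
open import Relation.Binary.PropositionalEquality
open import Relation.Nullary.Negation using (¬_)

Cauchy : (ℕ → ℚ) → Set
Cauchy f = ∀ ε → 0ℚ ℚ.< ε →
  ∃ λ N → ∀ m n → N ℕ.≤ m → N ℕ.≤ n → ∣ f m ℚ.- f n ∣ ℚ.≤ ε

record ℝ : Set where
  constructor mkℝ
  field
    seq    : ℕ → ℚ
    cauchy : Cauchy seq

open ℝ public

infix 4 _≈_ _<_ _≤_

-- Distinct Cauchy sequences may represent the same real: the equality
-- of reals is _≈_, not _≡_.
_≈_ : ℝ → ℝ → Set
x ≈ y = ∀ ε → 0ℚ ℚ.< ε →
  ∃ λ N → ∀ n → N ℕ.≤ n → ∣ seq x n ℚ.- seq y n ∣ ℚ.≤ ε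

_<_ : ℝ → ℝ → Set
x < y = ∃ λ ε → 0ℚ ℚ.< ε ×
  ∃ λ N → ∀ n → N ℕ.≤ n → seq x n ℚ.+ ε ℚ.≤ seq y n

-- The order of the constructive reals is not decidable; x ≤ y is the
-- negation of the strict order, which carries an explicit gap ε.
_≤_ : ℝ → ℝ → Set
x ≤ y = ¬ (y < x)

abstract

  half-pos : ∀ ε → 0ℚ ℚ.< ε → 0ℚ ℚ.< ½ ℚ.* ε
  half-pos ε 0<ε = subst (ℚ._< ½ ℚ.* ε) (ℚ.*-zeroʳ ½) (ℚ.*-monoʳ-<-pos ½ 0<ε)

  half+half : ∀ ε → ½ ℚ.* ε ℚ.+ ½ ℚ.* ε ≡ ε
  half+half ε = trans (sym (ℚ.*-distribʳ-+ ε ½ ½)) (ℚ.*-identityˡ ε)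

  const-cauchy : ∀ q → Cauchy (λ _ → q)
  const-cauchy q ε 0<ε = 0 , λ _ _ _ _ →
    ℚ.≤-trans (ℚ.≤-reflexive (cong ∣_∣ (ℚ.+-inverseʳ q))) (ℚ.<⇒≤ 0<ε)

  +-cauchy : ∀ f g → Cauchy f → Cauchy g → Cauchy (λ n → f n ℚ.+ g n)
  +-cauchy f g cf cg ε 0<ε
    with M , hM ← cf (½ ℚ.* ε) (half-pos ε 0<ε)
    with N , hN ← cg (½ ℚ.* ε) (half-pos ε 0<ε)
    = M ⊔ N , λ m n p q → begin
      ∣ (f m ℚ.+ g m) ℚ.- (f n ℚ.+ g n) ∣
        ≡⟨ cong ∣_∣ (regroup (f m) (g m) (f n) (g n)) ⟩
      ∣ (f m ℚ.- f n) ℚ.+ (g m ℚ.- g n) ∣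
        ≤⟨ ℚ.∣p+q∣≤∣p∣+∣q∣ (f m ℚ.- f n) (g m ℚ.- g n) ⟩
      ∣ f m ℚ.- f n ∣ ℚ.+ ∣ g m ℚ.- g n ∣
        ≤⟨ ℚ.+-mono-≤ (hM m n (m⊔n≤o⇒m≤o M N p) (m⊔n≤o⇒m≤o M N q))
                      (hN m n (m⊔n≤o⇒n≤o M N p) (m⊔n≤o⇒n≤o M N q)) ⟩
      ½ ℚ.* ε ℚ.+ ½ ℚ.* ε
        ≡⟨ half+half ε ⟩
      ε ∎
    where
    open ℚ.≤-Reasoning
    regroup : ∀ a b c d → (a ℚ.+ b) ℚ.- (c ℚ.+ d) ≡ (a ℚ.- c) ℚ.+ (b ℚ.- d)
    regroup = solve 4 (λ a b c d → (a :+ b) :- (c :+ d) := (a :- c) :+ (b :- d)) refl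
      where open +-*-Solver

  neg-cauchy : ∀ f → Cauchy f → Cauchy (λ n → ℚ.- f n)
  neg-cauchy f cf ε 0<ε with N , hN ← cf ε 0<ε = N , λ m n p q →
    subst (ℚ._≤ ε)
      (trans (sym (ℚ.∣-p∣≡∣p∣ (f m ℚ.- f n)))
             (cong ∣_∣ (ℚ.neg-distrib-+ (f m) (ℚ.- f n))))
      (hN m n p q)

  eventually-bounded : ∀ {f} → Cauchy f →
    ∃ λ B → 0ℚ ℚ.< B × ∃ λ N → ∀ n → N ℕ.≤ n → ∣ f n ∣ ℚ.≤ B
  eventually-bounded {f} cf with N , hN ← cf 1ℚ (ℚ.positive⁻¹ 1ℚ) =
    1ℚ ℚ.+ ∣ f N ∣ ,
    ℚ.+-mono-<-≤ (ℚ.positive⁻¹ 1ℚ) (ℚ.0≤∣p∣ (f N)) ,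
    N , λ n p → begin
      ∣ f n ∣
        ≡⟨ cong ∣_∣ (split (f n) (f N)) ⟩
      ∣ (f n ℚ.- f N) ℚ.+ f N ∣
        ≤⟨ ℚ.∣p+q∣≤∣p∣+∣q∣ (f n ℚ.- f N) (f N) ⟩
      ∣ f n ℚ.- f N ∣ ℚ.+ ∣ f N ∣
        ≤⟨ ℚ.+-monoˡ-≤ ∣ f N ∣ (hN n N p ℕ.≤-refl) ⟩
      1ℚ ℚ.+ ∣ f N ∣ ∎
    where
    open ℚ.≤-Reasoning
    split : ∀ a b → a ≡ (a ℚ.- b) ℚ.+ b
    split = solve 2 (λ a b → a := (a :- b) :+ b) refl
      where open +-*-Solver

  ∣*∣-bound : ∀ p q {B δ} → 0ℚ ℚ.< B → ∣ p ∣ ℚ.≤ B → ∣ q ∣ ℚ.≤ δ → ∣ p ℚ.* q ∣ ℚ.≤ B ℚ.* δ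
  ∣*∣-bound p q {B} {δ} 0<B p≤B q≤δ = begin
    ∣ p ℚ.* q ∣       ≡⟨ ℚ.∣p*q∣≡∣p∣*∣q∣ p q ⟩
    ∣ p ∣ ℚ.* ∣ q ∣   ≤⟨ ℚ.*-monoʳ-≤-nonNeg ∣ q ∣ {{nonNegative (ℚ.0≤∣p∣ q)}} p≤B ⟩
    B ℚ.* ∣ q ∣       ≤⟨ ℚ.*-monoˡ-≤-nonNeg B {{nonNegative (ℚ.<⇒≤ 0<B)}} q≤δ ⟩
    B ℚ.* δ           ∎
    where open ℚ.≤-Reasoning

  divide : ∀ B ε → 0ℚ ℚ.< B → 0ℚ ℚ.< ε → ∃ λ δ → 0ℚ ℚ.< δ × B ℚ.* δ ≡ ε
  divide B ε 0<B 0<ε = (1/ B) ℚ.* ε , 0<δ , Bδ≡ε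
    where
    instance
      B-pos : ℚ.Positive B
      B-pos = positive 0<B
      B≢0 : ℚ.NonZero B
      B≢0 = ℚ.pos⇒nonZero B
      1/B-pos : ℚ.Positive (1/ B)
      1/B-pos = ℚ.1/pos⇒pos B
    0<δ : 0ℚ ℚ.< (1/ B) ℚ.* ε
    0<δ = subst (ℚ._< (1/ B) ℚ.* ε) (ℚ.*-zeroʳ (1/ B)) (ℚ.*-monoʳ-<-pos (1/ B) 0<ε)
    Bδ≡ε : B ℚ.* ((1/ B) ℚ.* ε) ≡ ε
    Bδ≡ε = trans (sym (ℚ.*-assoc B (1/ B) ε))
             (trans (cong (ℚ._* ε) (ℚ.*-inverseʳ B)) (ℚ.*-identityˡ ε))

  *-cauchy : ∀ f g → Cauchy f → Cauchy g → Cauchy (λ n → f n ℚ.* g n)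
  *-cauchy f g cf cg ε 0<ε =
    let B , 0<B , K , hB = eventually-bounded cf
        C , 0<C , L , hC = eventually-bounded cg
        δ , 0<δ , Bδ≡½ε = divide B (½ ℚ.* ε) 0<B (half-pos ε 0<ε)
        η , 0<η , Cη≡½ε = divide C (½ ℚ.* ε) 0<C (half-pos ε 0<ε)
        M , hM = cg δ 0<δ
        N , hN = cf η 0<η
    in (K ⊔ L) ⊔ (M ⊔ N) , λ m n p q →
      let KLp = m⊔n≤o⇒m≤o (K ⊔ L) (M ⊔ N) p
          KLq = m⊔n≤o⇒m≤o (K ⊔ L) (M ⊔ N) q
          MNp = m⊔n≤o⇒n≤o (K ⊔ L) (M ⊔ N) p
          MNq = m⊔n≤o⇒n≤o (K ⊔ L) (M ⊔ N) q
      in begin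
      ∣ f m ℚ.* g m ℚ.- f n ℚ.* g n ∣
        ≡⟨ cong ∣_∣ (regroup (f m) (g m) (f n) (g n)) ⟩
      ∣ f m ℚ.* (g m ℚ.- g n) ℚ.+ g n ℚ.* (f m ℚ.- f n) ∣
        ≤⟨ ℚ.∣p+q∣≤∣p∣+∣q∣ (f m ℚ.* (g m ℚ.- g n)) (g n ℚ.* (f m ℚ.- f n)) ⟩
      ∣ f m ℚ.* (g m ℚ.- g n) ∣ ℚ.+ ∣ g n ℚ.* (f m ℚ.- f n) ∣
        ≤⟨ ℚ.+-mono-≤
             (∣*∣-bound (f m) (g m ℚ.- g n) 0<B
               (hB m (m⊔n≤o⇒m≤o K L KLp))
               (hM m n (m⊔n≤o⇒m≤o M N MNp) (m⊔n≤o⇒m≤o M N MNq)))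
             (∣*∣-bound (g n) (f m ℚ.- f n) 0<C
               (hC n (m⊔n≤o⇒n≤o K L KLq))
               (hN m n (m⊔n≤o⇒n≤o M N MNp) (m⊔n≤o⇒n≤o M N MNq))) ⟩
      B ℚ.* δ ℚ.+ C ℚ.* η
        ≡⟨ cong₂ ℚ._+_ Bδ≡½ε Cη≡½ε ⟩
      ½ ℚ.* ε ℚ.+ ½ ℚ.* ε
        ≡⟨ half+half ε ⟩
      ε ∎
    where
    open ℚ.≤-Reasoning
    regroup : ∀ a b c d →
      a ℚ.* b ℚ.- c ℚ.* d ≡ a ℚ.* (b ℚ.- d) ℚ.+ d ℚ.* (a ℚ.- c)
    regroup = solve 4
      (λ a b c d → a :* b :- c :* d := a :* (b :- d) :+ d :* (a :- c)) refl
      where open +-*-Solver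

infixl 6 _+_
infixl 7 _*_
infix  8 -_

_+_ : ℝ → ℝ → ℝ
x + y = mkℝ (λ n → seq x n ℚ.+ seq y n) (+-cauchy (seq x) (seq y) (cauchy x) (cauchy y))

_*_ : ℝ → ℝ → ℝ
x * y = mkℝ (λ n → seq x n ℚ.* seq y n) (*-cauchy (seq x) (seq y) (cauchy x) (cauchy y))

-_ : ℝ → ℝ
- x = mkℝ (λ n → ℚ.- seq x n) (neg-cauchy (seq x) (cauchy x))

fromℚ : ℚ → ℝ
fromℚ q = mkℝ (λ _ → q) (const-cauchy q)

fromℕ : ℕ → ℝ
fromℕ n = fromℚ (+ n ℚ./ 1)

0ℝ 1ℝ : ℝ
0ℝ = fromℚ 0ℚ
1ℝ = fromℚ 1ℚ

ℝ-rawRing : RawRing 0ℓ 0ℓ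
ℝ-rawRing = record
  { Carrier = ℝ
  ; _≈_     = _≈_
  ; _+_     = _+_
  ; _*_     = _*_
  ; -_      = -_
  ; 0#      = 0ℝ
  ; 1#      = 1ℝ
  }

open RawSemiringDefinitions (RawRing.rawSemiring ℝ-rawRing) public
  using (sum; product; _^_)

Matrix : ℕ → Set
Matrix n = Fin n → Fin n → ℝ

-- Laplace expansion along the first row.
det : ∀ {n} → Matrix n → ℝ
det {zero}  A = 1ℝ
det {suc n} A = sum λ j →
  (- 1ℝ) ^ toℕ j * A Fin.zero j * det (λ p q → A (Fin.suc p) (punchIn j q))

extendByZero : (ℕ → ℝ) → ℤ → ℝ
extendByZero u (+ k)    = u k
extendByZero u -[1+ _ ] = 0ℝ

-- _⊖_ : ℕ → ℕ → ℤ is the untruncated difference.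
toeplitz : (ℕ → ℝ) → ℕ → ℕ → ℝ
toeplitz u i j = extendByZero u (j ⊖ i)

StrictlyIncreasing : ∀ {n} → (Fin n → ℕ) → Set
StrictlyIncreasing r = r Preserves Fin._<_ ⟶ ℕ._<_

TotallyPositive : (ℕ → ℝ) → Set
TotallyPositive u = ∀ n (rows cols : Fin n → ℕ) →
  StrictlyIncreasing rows → StrictlyIncreasing cols →
  0ℝ ≤ det (λ p q → toeplitz u (rows p) (cols q))

pochhammer : ℕ → ℕ → ℕ
pochhammer a zero    = 1
pochhammer a (suc k) = pochhammer a k ℕ.* (a ℕ.+ k)

term : ∀ {m} → ℕ → Vector ℝ m → ℕ → ℝ
term a α k =
  fromℚ (ℚ._/_ (+ pochhammer a k) (k !) {{k !≢0}}) * product (λ i → fromℕ k + α i)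

{-# OPTIONS --safe #-}
module Submission where

-- A parameter equal to a can be absorbed in the Pochhammer symbol, because
-- (k + a) (a)_k / k! = a (a + 1)_k / k!.  By hypothesis this can be repeated
-- until no parameter exceeds a, so that all of them lie in [0 , a]
-- (minor-not-negative).
--
-- In that case the generating function is P(x) / (1 - x)^(a + m), where P
-- arises from the constant 1 by m operators
--   Λ P = (1 - x) (x P' + β P) + (a + d) x P,   d = deg P,  0 ≤ β ≤ a,
-- one for each factor k + β (θ-psumⁿ).  Suppose that P has d simple negative
-- roots and a positive leading coefficient and that 0 < β < a.  At the roots of P
-- the polynomial Λ P takes the values of x (1 - x) P', which alternate in sign;
-- moreover its value at 0 and its leading coefficient, which is a - β times
-- that of P, are positive.  So Λ P has d + 1 simple negative roots
-- (Λ-near-prodLin), and P is a positive multiple of a product of factors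
-- r + x with r > 0.  The cases β = 0 and β = a follow by perturbing β and a - β
-- (rootedLimit-Λ).
--
-- Multiplying the generating function by r + x replaces each row of the
-- Toeplitz matrix by a nonnegative combination of itself and the next row.
-- Dividing it by 1 - x replaces each row by the sum of all rows from there on.
-- As a minor is linear in each of its rows and vanishes when two adjacent rows
-- agree, both operations preserve the nonnegativity of all minors
-- (tp-mulLin, tp-psum).
--
-- Minors are continuous in the sequence, and this is used twice.  A negative
-- real minor would make the minors of rational approximations negative, so
-- it suffices to treat rational parameters in [0 , a] (tp-product).  For these
-- the roots of P may still be irrational.  Only rational approximations of the
-- roots are constructed: the small value of the polynomial at an approximate
-- root is subtracted before the linear factor is split off, and P is a
-- coefficientwise limit of products of rational linear factors (RootedLimit).

open import Algebra.Bundles using (CommutativeRing)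
open import Data.Fin.Base as Fin using (Fin; zero; suc; toℕ; punchIn; punchOut; fromℕ<)
import Data.Fin.Properties as Fin
open import Data.Integer.Base as ℤ using () renaming (+_ to ⁺_)
import Data.Integer.Properties as ℤ
open import Data.Nat.Base as ℕ using (ℕ; zero; suc; NonZero; s≤s; z≤n; _!)
import Data.Nat.Coprimality as Coprime
import Data.Nat.Properties as ℕ
import Data.Nat.Solver as ℕSolver
open import Data.Product.Base using (∃; _×_; _,_; proj₁; proj₂)
open import Data.Rational.Base as ℚ using (ℚ; mkℚ; 0ℚ; 1ℚ; ½; ∣_∣; toℚᵘ; *≤*; positive; nonNegative)
import Data.Rational.Properties as ℚ
open import Data.Rational.Solver using (module +-*-Solver)
import Data.Rational.Unnormalised.Base as ℚᵘ
import Data.Rational.Unnormalised.Properties as ℚᵘ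
open import Data.Sum.Base using (_⊎_; inj₁; inj₂; [_,_]′)
open import Data.Unit.Base using (⊤; tt)
open import Data.Vec.Base using (Vec; []; _∷_)
open import Data.Vec.Functional using (Vector; head; last; removeAt; updateAt)
open import Data.Vec.Functional.Properties using (updateAt-updates; updateAt-minimal)
open import Data.Vec.Relation.Unary.All as All using (All; []; _∷_)
open import Function.Base using (_∘_; const)
open import Relation.Binary.Core using (_Preserves_⟶_)
open import Relation.Binary.PropositionalEquality
open import Relation.Nullary.Decidable.Core using (Dec; yes; no; toWitness)
open import Relation.Nullary.Negation using (¬_; contradiction)
open +-*-Solver using (solve; _:+_; _:*_; _:-_; :-_; _:=_; con)

-- Results over ℚ; in this module the arithmetic and order symbols are those of ℚ.
module Rational where

  open import Data.Rational.Base using (_+_; _*_; -_; _-_; _≤_; _<_; _⊓_) renaming (_/_ to _÷ℤ_)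
  open import Defs using (half-pos; half+half; divide; ∣*∣-bound; pochhammer)
  open import Algebra.Properties.Semiring.Sum
    (CommutativeRing.semiring ℚ.+-*-commutativeRing) public
    using (*-distribˡ-sum; sum-replicate-zero)
    renaming (sum to sumℚ; sum-cong-≗ to sumℚ-cong; ∑-distrib-+ to sumℚ-distrib-+)
  open import Algebra.Properties.CommutativeMonoid.Sum ℚ.*-1-commutativeMonoid public
    using () renaming (sum to prodℚ; sum-remove to prodℚ-remove; sum-cong-≗ to prodℚ-cong)

  -- Arithmetic of the ordered field ℚ

  0≤+ : ∀ {p q} → 0ℚ ≤ p → 0ℚ ≤ q → 0ℚ ≤ p + q
  0≤+ {p} {q} 0≤p 0≤q = ℚ.+-mono-≤ 0≤p 0≤q

  0≤* : ∀ {p q} → 0ℚ ≤ p → 0ℚ ≤ q → 0ℚ ≤ p * q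
  0≤* {p} {q} 0≤p 0≤q =
    ℚ.nonNegative⁻¹ (p * q) {{ℚ.nonNeg*nonNeg⇒nonNeg p {{nonNegative 0≤p}} q {{nonNegative 0≤q}}}}

  0<1 : 0ℚ < 1ℚ
  0<1 = ℚ.positive⁻¹ 1ℚ

  0<* : ∀ {p q} → 0ℚ < p → 0ℚ < q → 0ℚ < p * q
  0<* {p} {q} 0<p 0<q = ℚ.positive⁻¹ (p * q) {{ℚ.pos*pos⇒pos p {{positive 0<p}} q {{positive 0<q}}}}

  p<q⇒0<q-p : ∀ {p q} → p < q → 0ℚ < q - p
  p<q⇒0<q-p {p} {q} p<q = subst (_< q - p) (ℚ.+-inverseʳ p) (ℚ.+-monoˡ-< (- p) p<q)

  p≤q⇒0≤q-p : ∀ {p q} → p ≤ q → 0ℚ ≤ q - p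
  p≤q⇒0≤q-p {p} {q} p≤q = subst (_≤ q - p) (ℚ.+-inverseʳ p) (ℚ.+-monoˡ-≤ (- p) p≤q)

  0<q-p⇒p<q : ∀ {p q} → 0ℚ < q - p → p < q
  0<q-p⇒p<q {p} {q} 0<q-p = subst₂ _<_ (ℚ.+-identityˡ p)
    (solve 2 (λ p q → q :- p :+ p := q) refl p q) (ℚ.+-monoˡ-< p 0<q-p)

  0≤q-p⇒p≤q : ∀ {p q} → 0ℚ ≤ q - p → p ≤ q
  0≤q-p⇒p≤q {p} {q} 0≤q-p = subst₂ _≤_ (ℚ.+-identityˡ p)
    (solve 2 (λ p q → q :- p :+ p := q) refl p q) (ℚ.+-monoˡ-≤ p 0≤q-p)

  p≤∣p∣ : ∀ p → p ≤ ∣ p ∣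
  p≤∣p∣ p with ℚ.≤-total 0ℚ p
  ... | inj₁ 0≤p = ℚ.≤-reflexive (sym (ℚ.0≤p⇒∣p∣≡p 0≤p))
  ... | inj₂ p≤0 = ℚ.≤-trans p≤0 (ℚ.0≤∣p∣ p)

  min-pos : ∀ {x y} → 0ℚ < x → 0ℚ < y → 0ℚ < x ⊓ y
  min-pos {x} {y} 0<x 0<y with ℚ.⊓-sel x y
  ... | inj₁ eq = subst (0ℚ <_) (sym eq) 0<x
  ... | inj₂ eq = subst (0ℚ <_) (sym eq) 0<y

  -- The embedding of the natural numbers.
  ι : ℕ → ℚ
  ι zero    = 0ℚ
  ι (suc n) = 1ℚ + ι n

  n/1-normal : ∀ n → ⁺ n ÷ℤ 1 ≡ mkℚ (⁺ n) 0 (Coprime.sym (Coprime.1-coprimeTo n))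
  n/1-normal n = ℚ.↥p/↧p≡p (mkℚ (⁺ n) 0 _)

  ι≡n/1 : ∀ n → ι n ≡ ⁺ n ÷ℤ 1
  ι≡n/1 zero    = refl
  ι≡n/1 (suc n) = trans (cong (_+_ 1ℚ) (trans (ι≡n/1 n) (n/1-normal n)))
    (cong (λ z → z ÷ℤ 1) (cong (ℤ._+_ (⁺ 1)) (ℤ.*-identityʳ (⁺ n))))

  0≤ι : ∀ n → 0ℚ ≤ ι n
  0≤ι zero    = ℚ.≤-refl
  0≤ι (suc n) = 0≤+ (ℚ.<⇒≤ 0<1) (0≤ι n)

  ι-+ : ∀ m n → ι (m ℕ.+ n) ≡ ι m + ι n
  ι-+ zero    n = sym (ℚ.+-identityˡ (ι n))
  ι-+ (suc m) n = trans (cong (_+_ 1ℚ) (ι-+ m n)) (sym (ℚ.+-assoc 1ℚ (ι m) (ι n)))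

  ι-* : ∀ m n → ι (m ℕ.* n) ≡ ι m * ι n
  ι-* zero    n = sym (ℚ.*-zeroˡ (ι n))
  ι-* (suc m) n = trans (ι-+ n (m ℕ.* n)) (trans (cong (_+_ (ι n)) (ι-* m n))
    (solve 2 (λ m n → n :+ m :* n := (con 1ℚ :+ m) :* n) refl (ι m) (ι n)))

  0<ι : ∀ n .{{_ : ℕ.NonZero n}} → 0ℚ < ι n
  0<ι (suc n) = ℚ.+-mono-<-≤ 0<1 (0≤ι n)

  ι-mono-≤ : ∀ {m n} → m ℕ.≤ n → ι m ≤ ι n
  ι-mono-≤ {n = n} z≤n = 0≤ι n
  ι-mono-≤ (s≤s m≤n) = ℚ.+-monoʳ-≤ 1ℚ (ι-mono-≤ m≤n)

  quotient-* : ∀ p q .{{_ : ℕ.NonZero q}} → (⁺ p ÷ℤ q) * ι q ≡ ι p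
  quotient-* p (suc q) = trans (cong ((⁺ p ÷ℤ suc q) *_) (ι≡n/1 (suc q))) (trans
    (ℚ.toℚᵘ-injective (begin
      toℚᵘ ((⁺ p ÷ℤ suc q) * (⁺ suc q ÷ℤ 1))
        ≈⟨ ℚ.toℚᵘ-homo-* (⁺ p ÷ℤ suc q) (⁺ suc q ÷ℤ 1) ⟩
      toℚᵘ (⁺ p ÷ℤ suc q) ℚᵘ.* toℚᵘ (⁺ suc q ÷ℤ 1)
        ≈⟨ ℚᵘ.*-cong (ℚ.toℚᵘ-fromℚᵘ (ℚᵘ.mkℚᵘ (⁺ p) q)) (ℚ.toℚᵘ-fromℚᵘ (ℚᵘ.mkℚᵘ (⁺ suc q) 0)) ⟩
      ℚᵘ.mkℚᵘ (⁺ p) q ℚᵘ.* ℚᵘ.mkℚᵘ (⁺ suc q) 0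
        ≈⟨ ℚᵘ.*≡* (trans (ℤ.*-identityʳ (⁺ p ℤ.* ⁺ suc q)) (cong (λ z → ⁺ p ℤ.* z)
             (cong ⁺_ (sym (ℕ.*-identityʳ (suc q)))))) ⟩
      ℚᵘ.mkℚᵘ (⁺ p) 0
        ≈⟨ ℚ.toℚᵘ-fromℚᵘ (ℚᵘ.mkℚᵘ (⁺ p) 0) ⟨
      toℚᵘ (⁺ p ÷ℤ 1) ∎))
    (sym (ι≡n/1 p)))
    where
    open ℚᵘ.≃-Reasoning

  archimedean : ∀ x → ∃ λ N → x ≤ ι N
  archimedean x@(mkℚ n d-1 _) = ℤ.∣ n ∣ , subst (x ≤_) (sym (trans (ι≡n/1 ℤ.∣ n ∣) (n/1-normal ℤ.∣ n ∣)))
    (*≤* (subst (ℤ._≤ ⁺ ℤ.∣ n ∣ ℤ.* ⁺ suc d-1) (sym (ℤ.*-identityʳ n)) (bound n)))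
    where
    bound : ∀ n → n ℤ.≤ ⁺ ℤ.∣ n ∣ ℤ.* ⁺ suc d-1
    bound (⁺ m) = subst (⁺ m ℤ.≤_) (ℤ.pos-* m (suc d-1)) (ℤ.+≤+ (ℕ.m≤m*n m (suc d-1)))
    bound ℤ.-[1+ m ] = subst (ℤ.-[1+ m ] ℤ.≤_) (ℤ.pos-* (suc m) (suc d-1)) ℤ.-≤+

  archimedean-step : ∀ {x h} → 0ℚ < x → 0ℚ < h → ∃ λ N → x ≤ ι N * h
  archimedean-step {x} {h} 0<x 0<h with y , _ , hy≡x ← divide h x 0<h 0<x with N , y≤N ← archimedean y =
    N , subst (_≤ ι N * h) (trans (ℚ.*-comm y h) hy≡x) (ℚ.*-monoʳ-≤-nonNeg h {{nonNegative (ℚ.<⇒≤ 0<h)}} y≤N)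

  close-refl : ∀ {x y ε} → x ≡ y → 0ℚ ≤ ε → ∣ x - y ∣ ≤ ε
  close-refl {x} refl 0≤ε = ℚ.≤-trans (ℚ.≤-reflexive (cong ∣_∣ (ℚ.+-inverseʳ x))) 0≤ε

  ∣p∣≤a⇒∣q∣≤b⇒∣p+q∣≤a+b : ∀ p q {a b} → ∣ p ∣ ≤ a → ∣ q ∣ ≤ b → ∣ p + q ∣ ≤ a + b
  ∣p∣≤a⇒∣q∣≤b⇒∣p+q∣≤a+b p q p≤a q≤b = ℚ.≤-trans (ℚ.∣p+q∣≤∣p∣+∣q∣ p q) (ℚ.+-mono-≤ p≤a q≤b)

  -- Determinants

  Mat : ℕ → Set
  Mat n = Fin n → Fin n → ℚ

  -- The power (- 1)^n.
  sgn : ℕ → ℚ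
  sgn zero    = 1ℚ
  sgn (suc n) = - 1ℚ * sgn n

  -- Deletes the first row and the column j.
  minor : ∀ {n} → Mat (suc n) → Fin (suc n) → Mat n
  minor A j p q = A (suc p) (punchIn j q)

  -- Laplace expansion along the first row.
  detℚ : ∀ {n} → Mat n → ℚ
  detℚ {zero}  A = 1ℚ
  detℚ {suc n} A = sumℚ λ j → sgn (toℕ j) * A zero j * detℚ (minor A j)

  det-cong : ∀ {n} {A B : Mat n} → (∀ p q → A p q ≡ B p q) → detℚ A ≡ detℚ B
  det-cong {zero}  eq = refl
  det-cong {suc n} eq = sumℚ-cong λ j →
    cong₂ (λ x y → sgn (toℕ j) * x * y) (eq zero j) (det-cong λ p q → eq (suc p) (punchIn j q))

  sumℚ-zero : ∀ {n} (f : Fin n → ℚ) → (∀ i → f i ≡ 0ℚ) → sumℚ f ≡ 0ℚ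
  sumℚ-zero {n} f eq = trans (sumℚ-cong eq) (sum-replicate-zero n)

  -- The matrices A, B, C agree outside row k, where A = c B + C.
  record RowLinear {n} (k : Fin n) (c : ℚ) (A B C : Mat n) : Set where
    field
      at-row  : ∀ q → A k q ≡ c * B k q + C k q
      off-row : ∀ p → p ≢ k → ∀ q → A p q ≡ B p q × A p q ≡ C p q

  det-linear : ∀ {n} {k : Fin n} {c} {A B C : Mat n} → RowLinear k c A B C →
    detℚ A ≡ c * detℚ B + detℚ C
  det-linear {suc n} {k} {c} {A} {B} {C} lin = begin
    sumℚ (t A)                        ≡⟨ sumℚ-cong (step k lin) ⟩
    sumℚ (λ j → c * t B j + t C j)    ≡⟨ sumℚ-distrib-+ (λ j → c * t B j) (t C) ⟩
    sumℚ (λ j → c * t B j) + sumℚ (t C) ≡⟨ cong (_+ sumℚ (t C)) (*-distribˡ-sum c (t B)) ⟨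
    c * sumℚ (t B) + sumℚ (t C) ∎
    where
    open ≡-Reasoning
    t : Mat (suc n) → Fin (suc n) → ℚ
    t M j = sgn (toℕ j) * M zero j * detℚ (minor M j)
    step : ∀ k → RowLinear k c A B C → ∀ j → t A j ≡ c * t B j + t C j
    step zero l j = begin
      s * A zero j * detℚ (minor A j)
        ≡⟨ cong (λ x → s * x * detℚ (minor A j)) (at-row j) ⟩
      s * (c * B zero j + C zero j) * detℚ (minor A j)
        ≡⟨ solve 5 (λ s c b d m → s :* (c :* b :+ d) :* m := c :* (s :* b :* m) :+ s :* d :* m)
             refl s c (B zero j) (C zero j) (detℚ (minor A j)) ⟩
      c * (s * B zero j * detℚ (minor A j)) + s * C zero j * detℚ (minor A j)
        ≡⟨ cong₂ (λ x y → c * (s * B zero j * x) + s * C zero j * y)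
             (det-cong λ p q → proj₁ (off-row (suc p) (λ ()) (punchIn j q)))
             (det-cong λ p q → proj₂ (off-row (suc p) (λ ()) (punchIn j q))) ⟩
      c * t B j + t C j ∎
      where
      open RowLinear l
      s = sgn (toℕ j)
    step (suc k) l j = begin
      s * A zero j * detℚ (minor A j)
        ≡⟨ cong (s * A zero j *_) (det-linear {k = k} {c} {minor A j} {minor B j} {minor C j} (record
             { at-row  = λ q → at-row (punchIn j q)
             ; off-row = λ p p≢k q → off-row (suc p) (λ { refl → p≢k refl }) (punchIn j q) })) ⟩
      s * A zero j * (c * detℚ (minor B j) + detℚ (minor C j))
        ≡⟨ solve 5 (λ s c a b d → s :* a :* (c :* b :+ d) := c :* (s :* a :* b) :+ s :* a :* d)
             refl s c (A zero j) (detℚ (minor B j)) (detℚ (minor C j)) ⟩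
      c * (s * A zero j * detℚ (minor B j)) + s * A zero j * detℚ (minor C j)
        ≡⟨ cong₂ (λ x y → c * (s * x * detℚ (minor B j)) + s * y * detℚ (minor C j))
             (proj₁ (off-row zero (λ ()) j)) (proj₂ (off-row zero (λ ()) j)) ⟩
      c * t B j + t C j ∎
      where
      open RowLinear l
      s = sgn (toℕ j)

  -- In a sum over ordered pairs of distinct columns, the pairs (i , j) and
  -- (j , i) carry opposite signs.  The third argument of f stands for the
  -- increasing enumeration of the remaining columns.
  alternating-sum : ∀ n (f : Fin (2 ℕ.+ n) → Fin (2 ℕ.+ n) → (Fin n → Fin (2 ℕ.+ n)) → ℚ) →
    (∀ i j ρ → f i j ρ ≡ f j i ρ) →
    (∀ i j {ρ σ} → (∀ q → ρ q ≡ σ q) → f i j ρ ≡ f i j σ) →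
    sumℚ (λ j → sumℚ (λ k →
      sgn (toℕ j) * sgn (toℕ k) * f j (punchIn j k) (λ q → punchIn j (punchIn k q)))) ≡ 0ℚ
  alternating-sum n f f-sym f-ext = begin
    sumℚ (row zero) + sumℚ (λ j → row (suc j) zero + sumℚ (row′ j))
      ≡⟨ cong (sumℚ (row zero) +_) (sumℚ-distrib-+ (λ j → row (suc j) zero) (λ j → sumℚ (row′ j))) ⟩
    sumℚ (row zero) + (sumℚ (λ j → row (suc j) zero) + sumℚ (λ j → sumℚ (row′ j)))
      ≡⟨ cong₂ (λ x y → sumℚ (row zero) + (x + y)) first-column (rest n f f-sym f-ext) ⟩
    sumℚ (row zero) + (- 1ℚ * sumℚ (row zero) + 0ℚ)
      ≡⟨ solve 1 (λ x → x :+ (:- con 1ℚ :* x :+ con 0ℚ) := con 0ℚ) refl (sumℚ (row zero)) ⟩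
    0ℚ ∎
    where
    open ≡-Reasoning
    row : Fin (2 ℕ.+ n) → Fin (suc n) → ℚ
    row j k = sgn (toℕ j) * sgn (toℕ k) * f j (punchIn j k) (λ q → punchIn j (punchIn k q))
    row′ : Fin (suc n) → Fin n → ℚ
    row′ j k = row (suc j) (suc k)
    first-column : sumℚ (λ j → row (suc j) zero) ≡ - 1ℚ * sumℚ (row zero)
    first-column = trans (sumℚ-cong λ j → begin
        - 1ℚ * sgn (toℕ j) * 1ℚ * f (suc j) zero _
          ≡⟨ cong (- 1ℚ * sgn (toℕ j) * 1ℚ *_) (f-sym _ _ _) ⟩
        - 1ℚ * sgn (toℕ j) * 1ℚ * f zero (suc j) _
          ≡⟨ solve 2 (λ s x → :- con 1ℚ :* s :* con 1ℚ :* x := :- con 1ℚ :* (con 1ℚ :* s :* x))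
               refl (sgn (toℕ j)) _ ⟩
        - 1ℚ * row zero j ∎)
      (sym (*-distribˡ-sum (- 1ℚ) (row zero)))
    rest : ∀ n (f : Fin (2 ℕ.+ n) → Fin (2 ℕ.+ n) → (Fin n → Fin (2 ℕ.+ n)) → ℚ) →
      (∀ i j ρ → f i j ρ ≡ f j i ρ) →
      (∀ i j {ρ σ} → (∀ q → ρ q ≡ σ q) → f i j ρ ≡ f i j σ) →
      sumℚ (λ (j : Fin (suc n)) → sumℚ (λ (k : Fin n) →
        sgn (suc (toℕ j)) * sgn (suc (toℕ k)) *
        f (suc j) (suc (punchIn j k)) (λ q → punchIn (suc j) (punchIn (suc k) q)))) ≡ 0ℚ
    rest zero    f _     _     = refl
    rest (suc n) f f-sym f-ext = trans
      (sumℚ-cong λ j → sumℚ-cong λ k → cong₂ _*_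
        (solve 2 (λ s t → (:- con 1ℚ :* s) :* (:- con 1ℚ :* t) := s :* t) refl (sgn (toℕ j)) (sgn (toℕ k)))
        (f-ext (suc j) (suc (punchIn j k))
          {λ q → punchIn (suc j) (punchIn (suc k) q)} {Fin.lift 1 λ q → punchIn j (punchIn k q)}
          λ { zero → refl ; (suc q) → refl }))
      (alternating-sum n (λ i j ρ → f (suc i) (suc j) (Fin.lift 1 ρ))
        (λ i j ρ → f-sym (suc i) (suc j) _)
        (λ i j eq → f-ext (suc i) (suc j) λ { zero → refl ; (suc q) → cong suc (eq q) }))

  det-equal-adjacent : ∀ {n} (A : Mat n) (k l : Fin n) → toℕ l ≡ suc (toℕ k) →
    (∀ q → A k q ≡ A l q) → detℚ A ≡ 0ℚ
  det-equal-adjacent {suc n} A (suc k) (suc l) l≡k+1 eq = sumℚ-zero _ λ j →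
    trans (cong (sgn (toℕ j) * A zero j *_)
            (det-equal-adjacent (minor A j) k l (cong ℕ.pred l≡k+1) (λ q → eq (punchIn j q))))
          (ℚ.*-zeroʳ (sgn (toℕ j) * A zero j))
  det-equal-adjacent {suc (suc n)} A zero (suc zero) _ eq = trans
    (sumℚ-cong λ j → trans
      (*-distribˡ-sum (sgn (toℕ j) * A zero j) (λ k → sgn (toℕ k) * A (suc zero) (punchIn j k) * D (punchIn j ∘ punchIn k)))
      (sumℚ-cong λ k →
        solve 5 (λ s a t b d → s :* a :* (t :* b :* d) := s :* t :* (a :* b :* d)) refl
          (sgn (toℕ j)) (A zero j) (sgn (toℕ k)) (A (suc zero) (punchIn j k)) (D (punchIn j ∘ punchIn k))))
    (alternating-sum n (λ i j ρ → A zero i * A (suc zero) j * D ρ)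
      (λ i j ρ → cong (_* D ρ) (trans (ℚ.*-comm (A zero i) (A (suc zero) j))
                                     (cong₂ _*_ (sym (eq j)) (eq i))))
      (λ i j ρ≗σ → cong (A zero i * A (suc zero) j *_)
                     (det-cong λ p q → cong (A (suc (suc p))) (ρ≗σ q))))
    where
    D : (Fin n → Fin (2 ℕ.+ n)) → ℚ
    D ρ = detℚ λ p q → A (suc (suc p)) (ρ q)

  det-zero-row : ∀ {n} (A : Mat n) (k : Fin n) → (∀ q → A k q ≡ 0ℚ) → detℚ A ≡ 0ℚ
  det-zero-row A k eq = trans (det-linear {k = k} {c = - 1ℚ} {A} {A} {A} (record
      { at-row  = λ q → trans (eq q) (sym (cong (λ x → - 1ℚ * x + x) (eq q)))
      ; off-row = λ _ _ _ → refl , refl }))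
    (solve 1 (λ x → :- con 1ℚ :* x :+ x := con 0ℚ) refl (detℚ A))

  det-zero-column : ∀ {n} (A : Mat (suc n)) → (∀ p → A p zero ≡ 0ℚ) → detℚ A ≡ 0ℚ

  -- Deleting a later column leaves the vanishing one in front.
  laplace-zero-column : ∀ {n} (A : Mat (suc n)) → (∀ p → A p zero ≡ 0ℚ) → ∀ j →
    sgn (toℕ j) * A zero j * detℚ (minor A j) ≡ 0ℚ
  laplace-zero-column A eq zero =
    trans (cong (λ x → 1ℚ * x * detℚ (minor A zero)) (eq zero)) (ℚ.*-zeroˡ (detℚ (minor A zero)))
  laplace-zero-column {suc n} A eq (suc j) = trans
    (cong (sgn (suc (toℕ j)) * A zero (suc j) *_)
      (det-zero-column (minor A (suc j)) (λ p → eq (suc p))))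
    (ℚ.*-zeroʳ (sgn (suc (toℕ j)) * A zero (suc j)))

  det-zero-column A eq = sumℚ-zero _ (laplace-zero-column A eq)

  -- Totally positive Toeplitz matrices

  sumℚ-nonneg : ∀ {n} (f : Fin n → ℚ) → (∀ i → 0ℚ ≤ f i) → 0ℚ ≤ sumℚ f
  sumℚ-nonneg {zero}  f 0≤f = ℚ.≤-refl
  sumℚ-nonneg {suc n} f 0≤f = 0≤+ (0≤f zero) (sumℚ-nonneg (f ∘ suc) (0≤f ∘ suc))

  -- Sequences, regarded as power series or polynomials through their
  -- generating functions.
  Seq : Set
  Seq = ℕ → ℚ

  StrictInc : ∀ {n} → (Fin n → ℕ) → Set
  StrictInc ρ = ρ Preserves Fin._<_ ⟶ ℕ._<_

  weakly-increasing-strict-or-repeats : ∀ {n} (ρ : Fin n → ℕ) → ρ Preserves Fin._<_ ⟶ ℕ._≤_ →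
    StrictInc ρ ⊎ ∃ λ k → ∃ λ l → toℕ l ≡ suc (toℕ k) × ρ k ≡ ρ l
  weakly-increasing-strict-or-repeats {zero}        ρ ρ≤ = inj₁ λ { {()} }
  weakly-increasing-strict-or-repeats {suc zero}    ρ ρ≤ = inj₁ λ { {zero} {zero} () }
  weakly-increasing-strict-or-repeats {suc (suc n)} ρ ρ≤
    with ℕ.m≤n⇒m<n∨m≡n (ρ≤ {zero} {suc zero} (s≤s z≤n))
       | weakly-increasing-strict-or-repeats (ρ ∘ suc) (λ p<q → ρ≤ (s≤s p<q))
  ... | inj₂ ρ0≡ρ1 | _ = inj₂ (zero , suc zero , refl , ρ0≡ρ1)
  ... | inj₁ _     | inj₂ (k , l , l≡k+1 , eq) = inj₂ (suc k , suc l , cong suc l≡k+1 , eq)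
  ... | inj₁ ρ0<ρ1 | inj₁ ρ< = inj₁ strict
    where
    strict : StrictInc ρ
    strict {zero}  {suc zero}    _         = ρ0<ρ1
    strict {zero}  {suc (suc q)} _         = ℕ.<-trans ρ0<ρ1 (ρ< (s≤s z≤n))
    strict {suc p} {suc q}       (s≤s p<q) = ρ< p<q

  replaceRow : ∀ {n} → Mat n → Fin n → (Fin n → ℚ) → Mat n
  replaceRow A k v = updateAt A k (const v)

  replaceRow-same : ∀ {n} (A : Mat n) k v → replaceRow A k v k ≡ v
  replaceRow-same A k v = updateAt-updates k A

  replaceRow-other : ∀ {n} (A : Mat n) k v {p} → p ≢ k → replaceRow A k v p ≡ A p
  replaceRow-other A k v {p} p≢k = updateAt-minimal p k A p≢k

  det-split-row : ∀ {n} (A : Mat n) k c v w → (∀ q → A k q ≡ c * v q + w q) →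
    detℚ A ≡ c * detℚ (replaceRow A k v) + detℚ (replaceRow A k w)
  det-split-row A k c v w eq = det-linear {k = k} {c} record
    { at-row  = λ q → trans (eq q) (cong₂ (λ v w → c * v q + w q)
        (sym (replaceRow-same A k v)) (sym (replaceRow-same A k w)))
    ; off-row = λ p p≢k q →
        cong (λ f → f q) (sym (replaceRow-other A k v p≢k)) ,
        cong (λ f → f q) (sym (replaceRow-other A k w p≢k)) }

  -- R lists the rows of a matrix with infinitely many rows and n columns.
  module _ {n : ℕ} (R : ℕ → Fin n → ℚ) where

    -- The convex cone spanned by the rows R lo , ... , R hi.
    data Cone (lo hi : ℕ) (v : Fin n → ℚ) : Set where
      nil  : (∀ q → v q ≡ 0ℚ) → Cone lo hi v
      cons : ∀ {c i w} → 0ℚ ≤ c → lo ℕ.≤ i → i ℕ.≤ hi → Cone lo hi w →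
             (∀ q → v q ≡ c * R i q + w q) → Cone lo hi v

    cone-widen : ∀ {lo lo′ hi v} → lo′ ℕ.≤ lo → Cone lo hi v → Cone lo′ hi v
    cone-widen le (nil v≗0) = nil v≗0
    cone-widen le (cons 0≤c l h cn split) = cons 0≤c (ℕ.≤-trans le l) h (cone-widen le cn) split

    -- Rows drawn from the cones of consecutive blocks of R: the expansion of
    -- the determinant only meets rows of R in weakly increasing order, and
    -- vanishes unless they are distinct.
    det-cone-nonneg : (∀ ρ → StrictInc ρ → 0ℚ ≤ detℚ (R ∘ ρ)) →
      ∀ (lo hi : Fin n → ℕ) → (∀ {p q} → p Fin.< q → hi p ℕ.≤ lo q) →
      ∀ A → (∀ p → Cone (lo p) (hi p) (A p)) → 0ℚ ≤ detℚ A
    det-cone-nonneg R-nonneg lo hi hi≤lo A cones =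
      go n A (λ p _ → cones p) (λ p n≤p → contradiction (Fin.toℕ<n p) (ℕ.≤⇒≯ n≤p))
      where
      Pure : Fin n → (Fin n → ℚ) → Set
      Pure p v = ∃ λ i → lo p ℕ.≤ i × i ℕ.≤ hi p × (∀ q → v q ≡ R i q)

      pure : ∀ A → (∀ p → Pure p (A p)) → 0ℚ ≤ detℚ A
      pure A rows with weakly-increasing-strict-or-repeats (proj₁ ∘ rows) (λ {p} {q} p<q →
        ℕ.≤-trans (proj₁ (proj₂ (proj₂ (rows p)))) (ℕ.≤-trans (hi≤lo p<q) (proj₁ (proj₂ (rows q)))))
      ... | inj₁ ρ< = subst (0ℚ ≤_) (det-cong λ p q → sym (proj₂ (proj₂ (proj₂ (rows p))) q))
                        (R-nonneg (proj₁ ∘ rows) ρ<)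
      ... | inj₂ (k , l , l≡k+1 , eq) = ℚ.≤-reflexive (sym (det-equal-adjacent A k l l≡k+1 λ q →
        trans (proj₂ (proj₂ (proj₂ (rows k))) q)
          (trans (cong (λ i → R i q) eq) (sym (proj₂ (proj₂ (proj₂ (rows l))) q)))))

      -- The first k rows lie in the cones, the others are rows of R.
      go : ∀ k A → (∀ p → toℕ p ℕ.< k → Cone (lo p) (hi p) (A p)) →
           (∀ p → k ℕ.≤ toℕ p → Pure p (A p)) → 0ℚ ≤ detℚ A
      go zero    A _     pures = pure A (λ p → pures p z≤n)
      go (suc k) A cones pures with k ℕ.<? n
      ... | no k≮n = go k A (λ p p<k → cones p (ℕ.m≤n⇒m≤1+n p<k))
                       (λ p k≤p → contradiction (ℕ.≤-<-trans k≤p (Fin.toℕ<n p)) k≮n)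
      ... | yes k<n = expand (cones r (s≤s (ℕ.≤-reflexive r≡k))) A refl
                        (λ p p<k → cones p (ℕ.m≤n⇒m≤1+n p<k)) pures
        where
        r = fromℕ< k<n
        r≡k : toℕ r ≡ k
        r≡k = Fin.toℕ-fromℕ< k<n
        below : ∀ {p} → toℕ p ℕ.< k → p ≢ r
        below p<k refl = ℕ.<⇒≢ p<k r≡k
        above : ∀ {p} → suc k ℕ.≤ toℕ p → p ≢ r
        above k<p refl = ℕ.<⇒≢ k<p (sym r≡k)
        expand : ∀ {v} → Cone (lo r) (hi r) v → ∀ A → A r ≡ v →
          (∀ p → toℕ p ℕ.< k → Cone (lo p) (hi p) (A p)) →
          (∀ p → suc k ℕ.≤ toℕ p → Pure p (A p)) → 0ℚ ≤ detℚ A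
        expand (nil A≗0) A refl _ _ = ℚ.≤-reflexive (sym (det-zero-row A r A≗0))
        expand (cons {c} {i} {w} 0≤c lo≤i i≤hi cone split) A refl cones pures =
          subst (0ℚ ≤_) (sym (det-split-row A r c (R i) w split)) (0≤+
            (0≤* 0≤c (go k (replaceRow A r (R i))
              (λ p p<k → subst (Cone (lo p) (hi p)) (sym (replaceRow-other A r (R i) (below p<k))) (cones p p<k))
              pures′))
            (expand cone (replaceRow A r w) (replaceRow-same A r w)
              (λ p p<k → subst (Cone (lo p) (hi p)) (sym (replaceRow-other A r w (below p<k))) (cones p p<k))
              (λ p k<p → subst (Pure p) (sym (replaceRow-other A r w (above k<p))) (pures p k<p))))
          where
          pures′ : ∀ p → k ℕ.≤ toℕ p → Pure p (replaceRow A r (R i) p)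
          pures′ p k≤p with p Fin.≟ r
          ... | yes refl = i , lo≤i , i≤hi , λ q → cong (λ f → f q) (replaceRow-same A r (R i))
          ... | no p≢r = subst (Pure p) (sym (replaceRow-other A r (R i) p≢r))
            (pures p (ℕ.≤∧≢⇒< k≤p λ k≡p → p≢r (Fin.toℕ-injective (trans (sym k≡p) (sym r≡k)))))

  -- Multiplication of the generating function by x.
  shift : Seq → Seq
  shift u zero    = 0ℚ
  shift u (suc j) = u j

  -- Multiplication of the generating function by r + x.
  mulLin : ℚ → Seq → Seq
  mulLin r u j = r * u j + shift u j

  -- Division of the generating function by 1 - x.
  psum : Seq → Seq
  psum u zero    = u zero
  psum u (suc k) = psum u k + u (suc k)

  psum-rec : ∀ u k → psum u k ≡ u k + shift (psum u) k
  psum-rec u zero    = sym (ℚ.+-identityʳ (u zero))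
  psum-rec u (suc k) = ℚ.+-comm (psum u k) (u (suc k))

  -- The entry (i , j) of the Toeplitz matrix of u.
  tz : Seq → ℕ → ℕ → ℚ
  tz u zero    j       = u j
  tz u (suc i) zero    = 0ℚ
  tz u (suc i) (suc j) = tz u i j

  tz-shift : ∀ u i j → tz (shift u) i j ≡ tz u (suc i) j
  tz-shift u zero    zero    = refl
  tz-shift u zero    (suc j) = refl
  tz-shift u (suc i) zero    = refl
  tz-shift u (suc i) (suc j) = tz-shift u i j

  tz-linear : ∀ {u v w} r → (∀ k → u k ≡ r * v k + w k) → ∀ i j → tz u i j ≡ r * tz v i j + tz w i j
  tz-linear r eq zero    j       = eq j
  tz-linear r eq (suc i) zero    = sym (trans (ℚ.+-identityʳ (r * 0ℚ)) (ℚ.*-zeroʳ r))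
  tz-linear r eq (suc i) (suc j) = tz-linear r eq i j

  tz-below : ∀ u {i j} → j ℕ.< i → tz u i j ≡ 0ℚ
  tz-below u {suc i} {zero}  _         = refl
  tz-below u {suc i} {suc j} (s≤s j<i) = tz-below u j<i

  -- Total positivity of a rational sequence.
  TPℚ : Seq → Set
  TPℚ u = ∀ {n} (rows cols : Fin n → ℕ) → StrictInc rows → StrictInc cols →
    0ℚ ≤ detℚ (λ p q → tz u (rows p) (cols q))

  tp-mulLin : ∀ {r u} → 0ℚ ≤ r → TPℚ u → TPℚ (mulLin r u)
  tp-mulLin {r} {u} 0≤r tp rows cols rows< cols< =
    det-cone-nonneg R (λ ρ ρ< → tp ρ cols ρ< cols<) rows (λ p → suc (rows p)) rows< _ λ p →
      cons 0≤r ℕ.≤-refl (ℕ.n≤1+n _)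
        (cons (ℚ.nonNegative⁻¹ 1ℚ) (ℕ.n≤1+n _) ℕ.≤-refl (nil λ _ → refl) λ q →
          solve 1 (λ x → x := con 1ℚ :* x :+ con 0ℚ) refl (R (suc (rows p)) q))
        λ q → trans (tz-linear {v = u} {w = shift u} r (λ _ → refl) (rows p) (cols q))
                (cong (r * R (rows p) q +_) (tz-shift u (rows p) (cols q)))
    where
    R : ℕ → _ → ℚ
    R i q = tz u i (cols q)

  bounded-above : ∀ {n} (f : Fin n → ℕ) → ∃ λ M → ∀ q → f q ℕ.< M
  bounded-above {zero}  f = 0 , λ ()
  bounded-above {suc n} f with M , f<M ← bounded-above (f ∘ suc) =
    suc (f zero) ℕ.⊔ M , λ where
      zero    → ℕ.m≤m⊔n (suc (f zero)) M
      (suc q) → ℕ.≤-trans (f<M q) (ℕ.m≤n⊔m (suc (f zero)) M)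

  -- The row i of the Toeplitz matrix of psum u is the sum of the rows i , i + 1 , ...
  -- of that of u.  Subtracting from each row of a minor the next one leaves sums
  -- over disjoint blocks of rows.
  tp-psum : ∀ {u} → TPℚ u → TPℚ (psum u)
  tp-psum {u} tp {n} rows cols rows< cols< =
    go n zero (ℕ.+-identityʳ n) _ (λ _ ()) (λ _ _ _ → refl)
    where
    R P : ℕ → Fin n → ℚ
    R i q = tz u i (cols q)
    P i q = tz (psum u) i (cols q)

    P-step : ∀ i q → P i q ≡ 1ℚ * R i q + P (suc i) q
    P-step i q = trans (tz-linear {v = u} {w = shift (psum u)} 1ℚ
        (λ k → trans (psum-rec u k) (cong (_+ shift (psum u) k) (sym (ℚ.*-identityˡ (u k))))) i (cols q))
      (cong (1ℚ * R i q +_) (tz-shift (psum u) i (cols q)))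

    blocks : ∀ d i → ∃ λ W → Cone R i (d ℕ.+ i) W × (∀ q → P i q ≡ 1ℚ * W q + P (d ℕ.+ i) q)
    blocks zero    i = (λ _ → 0ℚ) , nil (λ _ → refl) , λ q →
      solve 1 (λ x → x := con 1ℚ :* con 0ℚ :+ x) refl (P i q)
    blocks (suc d) i with W , cone , eq ← blocks d (suc i) rewrite ℕ.+-suc d i =
      (λ q → 1ℚ * R i q + W q) ,
      cons (ℚ.nonNegative⁻¹ 1ℚ) ℕ.≤-refl (ℕ.m≤n+m i (suc d)) (cone-widen R (ℕ.n≤1+n i) cone) (λ _ → refl) ,
      λ q → trans (P-step i q) (trans (cong (1ℚ * R i q +_) (eq q))
        (solve 3 (λ r w x → con 1ℚ :* r :+ (con 1ℚ :* w :+ x) := con 1ℚ :* (con 1ℚ :* r :+ w) :+ x) refl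
          (R i q) (W q) (P (suc d ℕ.+ i) q)))

    -- From row M on the matrix vanishes in the given columns.
    M : ℕ
    M = proj₁ (bounded-above cols) ℕ.⊔ proj₁ (bounded-above rows)

    P-M : ∀ q → P M q ≡ 0ℚ
    P-M q = tz-below (psum u) (ℕ.≤-trans (proj₂ (bounded-above cols) q) (ℕ.m≤m⊔n _ _))

    rows≤M : ∀ p → rows p ℕ.≤ M
    rows≤M p = ℕ.≤-trans (ℕ.<⇒≤ (proj₂ (bounded-above rows) p)) (ℕ.m≤n⊔m (proj₁ (bounded-above cols)) _)

    next : ∀ p → (∃ λ l → toℕ l ≡ suc (toℕ p)) ⊎ n ℕ.≤ suc (toℕ p)
    next p with suc (toℕ p) ℕ.<? n
    ... | yes lt = inj₁ (fromℕ< lt , Fin.toℕ-fromℕ< lt)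
    ... | no ¬lt = inj₂ (ℕ.≮⇒≥ ¬lt)

    -- The end of the block of row p: the start of the next block, or M.
    end : Fin n → ℕ
    end p = [ (λ l → rows (proj₁ l)) , const M ]′ (next p)

    start≤end : ∀ p → rows p ℕ.≤ end p
    start≤end p with next p
    ... | inj₁ (l , l≡p+1) = ℕ.<⇒≤ (rows< (ℕ.≤-reflexive (sym l≡p+1)))
    ... | inj₂ _ = rows≤M p

    end≤start : ∀ {p q} → p Fin.< q → end p ℕ.≤ rows q
    end≤start {p} {q} p<q with next p
    ... | inj₂ n≤p+1 = contradiction (ℕ.<-≤-trans (Fin.toℕ<n q) n≤p+1) (ℕ.≤⇒≯ p<q)
    ... | inj₁ (l , l≡p+1) with ℕ.m≤n⇒m<n∨m≡n (subst (ℕ._≤ toℕ q) (sym l≡p+1) p<q)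
    ...   | inj₁ l<q = ℕ.<⇒≤ (rows< l<q)
    ...   | inj₂ l≡q = ℕ.≤-reflexive (cong rows (Fin.toℕ-injective l≡q))

    block : ∀ p → ∃ λ W → Cone R (rows p) (end p) W × (∀ q → P (rows p) q ≡ 1ℚ * W q + P (end p) q)
    block p = subst (λ e → ∃ λ W → Cone R (rows p) e W × (∀ q → P (rows p) q ≡ 1ℚ * W q + P e q))
      (ℕ.m∸n+n≡m (start≤end p)) (blocks (end p ℕ.∸ rows p) (rows p))

    -- The first k rows are reduced to their blocks, the f others are still
    -- rows of P.
    go : ∀ f k → f ℕ.+ k ≡ n → ∀ A → (∀ p → toℕ p ℕ.< k → Cone R (rows p) (end p) (A p)) →
         (∀ p → k ℕ.≤ toℕ p → ∀ q → A p q ≡ P (rows p) q) → 0ℚ ≤ detℚ A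
    go zero k refl A cones _ =
      det-cone-nonneg R (λ ρ ρ< → tp ρ cols ρ< cols<) rows end end≤start A (λ p → cones p (Fin.toℕ<n p))
    go (suc f) k f+k≡n A cones tails = subst (0ℚ ≤_) (sym split)
      (go f (suc k) (trans (ℕ.+-suc f k) f+k≡n) (replaceRow A r W) cones′
        λ p k<p q → trans (cong (λ f → f q) (replaceRow-other A r W (above k<p))) (tails p (ℕ.<⇒≤ k<p) q))
      where
      k<n : k ℕ.< n
      k<n = subst (k ℕ.<_) f+k≡n (s≤s (ℕ.m≤n+m k f))
      r = fromℕ< k<n
      r≡k : toℕ r ≡ k
      r≡k = Fin.toℕ-fromℕ< k<n
      above : ∀ {p} → suc k ℕ.≤ toℕ p → p ≢ r
      above k<p refl = ℕ.<⇒≢ k<p (sym r≡k)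
      W = proj₁ (block r)
      cones′ : ∀ p → toℕ p ℕ.< suc k → Cone R (rows p) (end p) (replaceRow A r W p)
      cones′ p p≤k with p Fin.≟ r
      ... | yes refl = subst (Cone R _ _) (sym (replaceRow-same A r W)) (proj₁ (proj₂ (block r)))
      ... | no p≢r = subst (Cone R _ _) (sym (replaceRow-other A r W p≢r))
        (cones p (ℕ.≤∧≢⇒< (ℕ.s≤s⁻¹ p≤k) λ p≡k → p≢r (Fin.toℕ-injective (trans p≡k (sym r≡k)))))
      vanishing : detℚ (replaceRow A r (P (end r))) ≡ 0ℚ
      vanishing with next r
      ... | inj₁ (l , l≡r+1) = det-equal-adjacent _ r l l≡r+1 λ q → trans
        (cong (λ f → f q) (replaceRow-same A r (P (rows l))))
        (sym (trans (cong (λ f → f q) (replaceRow-other A r (P (rows l)) (above k<l)))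
                    (tails l (ℕ.<⇒≤ k<l) q)))
        where
        k<l : k ℕ.< toℕ l
        k<l = ℕ.≤-reflexive (sym (trans l≡r+1 (cong suc r≡k)))
      ... | inj₂ _ = det-zero-row _ r λ q → trans (cong (λ f → f q) (replaceRow-same A r (P M))) (P-M q)
      split : detℚ A ≡ detℚ (replaceRow A r W)
      split = trans
        (det-split-row A r 1ℚ W (P (end r)) λ q →
          trans (tails r (ℕ.≤-reflexive (sym r≡k)) q) (proj₂ (proj₂ (block r)) q))
        (trans (cong (1ℚ * detℚ (replaceRow A r W) +_) vanishing)
          (solve 1 (λ x → con 1ℚ :* x :+ con 0ℚ := x) refl (detℚ (replaceRow A r W))))

  tz-nonneg : ∀ {u} → (∀ k → 0ℚ ≤ u k) → ∀ i j → 0ℚ ≤ tz u i j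
  tz-nonneg 0≤u zero    j       = 0≤u j
  tz-nonneg 0≤u (suc i) zero    = ℚ.≤-refl
  tz-nonneg 0≤u (suc i) (suc j) = tz-nonneg 0≤u i j

  -- The coefficients of the constant c.
  constant : ℚ → Seq
  constant c zero    = c
  constant c (suc j) = 0ℚ

  tz-constant-off-diagonal : ∀ c {i j} → i ≢ j → tz (constant c) i j ≡ 0ℚ
  tz-constant-off-diagonal c {zero}  {zero}  i≢j = contradiction refl i≢j
  tz-constant-off-diagonal c {zero}  {suc j} _   = refl
  tz-constant-off-diagonal c {suc i} {zero}  _   = refl
  tz-constant-off-diagonal c {suc i} {suc j} i≢j = tz-constant-off-diagonal c (i≢j ∘ cong suc)

  tp-constant : ∀ {c} → 0ℚ ≤ c → TPℚ (constant c)
  tp-constant 0≤c {zero} _ _ _ _ = ℚ.nonNegative⁻¹ 1ℚ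
  tp-constant {c} 0≤c {suc n} rows cols rows< cols< = sumℚ-nonneg _ term
    where
    A : Mat (suc n)
    A p q = tz (constant c) (rows p) (cols q)
    0≤constant : ∀ k → 0ℚ ≤ constant c k
    0≤constant zero    = 0≤c
    0≤constant (suc k) = ℚ.≤-refl
    -- If the first row meets a later column in a nonzero entry, then the
    -- first column vanishes below the first row.
    later : ∀ {n} (rows cols : Fin (suc n) → ℕ) → StrictInc rows → StrictInc cols →
      ∀ j → let A = λ p q → tz (constant c) (rows p) (cols q) in
      sgn (suc (toℕ j)) * A zero (suc j) * detℚ (minor A (suc j)) ≡ 0ℚ
    later {suc n} rows cols rows< cols< j with rows zero ℕ.≟ cols (suc j)
    ... | no  ≢ = trans
      (cong (λ x → sgn (suc (toℕ j)) * x * D) (tz-constant-off-diagonal c ≢))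
      (solve 2 (λ s d → s :* con 0ℚ :* d := con 0ℚ) refl (sgn (suc (toℕ j))) D)
      where D = detℚ (minor (λ p q → tz (constant c) (rows p) (cols q)) (suc j))
    ... | yes ≡ = trans
      (cong (sgn (suc (toℕ j)) * tz (constant c) (rows zero) (cols (suc j)) *_)
        (det-zero-column (minor (λ p q → tz (constant c) (rows p) (cols q)) (suc j))
          λ p → tz-below (constant c) (ℕ.<-trans
            (subst (cols zero ℕ.<_) (sym ≡) (cols< (s≤s z≤n))) (rows< {zero} {suc p} (s≤s z≤n)))))
      (ℚ.*-zeroʳ (sgn (suc (toℕ j)) * tz (constant c) (rows zero) (cols (suc j))))
    term : ∀ j → 0ℚ ≤ sgn (toℕ j) * A zero j * detℚ (minor A j)
    term zero = 0≤* (subst (0ℚ ≤_) (sym (ℚ.*-identityˡ (A zero zero)))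
                       (tz-nonneg 0≤constant (rows zero) (cols zero)))
      (tp-constant 0≤c (rows ∘ suc) (cols ∘ suc) (λ p<q → rows< (s≤s p<q)) (λ p<q → cols< (s≤s p<q)))
    term (suc j) = ℚ.≤-reflexive (sym (later rows cols rows< cols< j))

  tp-cong : ∀ {u v} → (∀ k → u k ≡ v k) → TPℚ u → TPℚ v
  tp-cong {u} {v} eq tp rows cols rows< cols< =
    subst (0ℚ ≤_) (det-cong λ p q → tz-cong (rows p) (cols q)) (tp rows cols rows< cols<)
    where
    tz-cong : ∀ i j → tz u i j ≡ tz v i j
    tz-cong zero    j       = eq j
    tz-cong (suc i) zero    = refl
    tz-cong (suc i) (suc j) = tz-cong i j

  -- Asymptotic equality along a filter

  -- Functions on X are compared along a filter, given by a base of
  -- subsets of X, the relation B ⊩ x being membership.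
  module Asymptotics {X Base : Set} (_⊩_ : Base → X → Set) (whole : Base) (_∩_ : Base → Base → Base)
    (∩ˡ : ∀ {B C x} → (B ∩ C) ⊩ x → B ⊩ x) (∩ʳ : ∀ {B C x} → (B ∩ C) ⊩ x → C ⊩ x) where

    -- P holds on some member of the base.
    Eventually : (X → Set) → Set
    Eventually P = ∃ λ B → ∀ x → B ⊩ x → P x

    eventually-× : ∀ {P Q R : X → Set} → (∀ x → P x → Q x → R x) → Eventually P → Eventually Q → Eventually R
    eventually-× f (B , p) (C , q) = B ∩ C , λ x x∈ → f x (p x (∩ˡ x∈)) (q x (∩ʳ x∈))

    Bounded : (X → ℚ) → Set
    Bounded f = ∃ λ M → 0ℚ < M × Eventually λ x → ∣ f x ∣ ≤ M

    infix 4 _≃_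
    -- Eventually bounded functions whose difference tends to 0.
    record _≃_ (f g : X → ℚ) : Set where
      constructor mk≃
      field
        boundedˡ : Bounded f
        boundedʳ : Bounded g
        close    : ∀ ε → 0ℚ < ε → Eventually λ x → ∣ f x - g x ∣ ≤ ε
    open _≃_ public

    ≃-refl : ∀ {f} → Bounded f → f ≃ f
    ≃-refl {f} b = mk≃ b b λ ε 0<ε → whole , λ x _ → close-refl {f x} refl (ℚ.<⇒≤ 0<ε)

    ≃-const : ∀ c → (λ _ → c) ≃ (λ _ → c)
    ≃-const c = ≃-refl (∣ c ∣ + 1ℚ , ℚ.+-mono-≤-< (ℚ.0≤∣p∣ c) 0<1 , whole , λ _ _ →
      subst (_≤ ∣ c ∣ + 1ℚ) (ℚ.+-identityʳ ∣ c ∣) (ℚ.+-monoʳ-≤ ∣ c ∣ (ℚ.<⇒≤ 0<1)))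

    ≃-cong : ∀ {f f′ g g′} → (∀ x → f x ≡ f′ x) → (∀ x → g x ≡ g′ x) → f ≃ g → f′ ≃ g′
    ≃-cong {f} {f′} {g} {g′} f≗f′ g≗g′ (mk≃ (M , 0<M , B , bf) (N , 0<N , C , bg) cl) =
      mk≃ (M , 0<M , B , λ x x∈ → subst (λ y → ∣ y ∣ ≤ M) (f≗f′ x) (bf x x∈))
          (N , 0<N , C , λ x x∈ → subst (λ y → ∣ y ∣ ≤ N) (g≗g′ x) (bg x x∈))
          λ ε 0<ε → let D , near = cl ε 0<ε in
            D , λ x x∈ → subst₂ (λ y z → ∣ y - z ∣ ≤ ε) (f≗f′ x) (g≗g′ x) (near x x∈)

    -- A function close to a bounded one is bounded.
    ≃-limit : ∀ {f g} → Bounded g → (∀ ε → 0ℚ < ε → Eventually λ x → ∣ f x - g x ∣ ≤ ε) → f ≃ g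
    ≃-limit {f} {g} (M , 0<M , bg) lim = mk≃
      (1ℚ + M , ℚ.+-mono-< 0<1 0<M , eventually-×
        (λ x near b → subst (λ y → ∣ y ∣ ≤ 1ℚ + M) (solve 2 (λ f g → f :- g :+ g := f) refl (f x) (g x))
          (∣p∣≤a⇒∣q∣≤b⇒∣p+q∣≤a+b (f x - g x) (g x) near b)) (lim 1ℚ 0<1) bg)
      (M , 0<M , bg) lim

    Bounded-+ : ∀ {f g} → Bounded f → Bounded g → Bounded (λ x → f x + g x)
    Bounded-+ {f} {g} (M , 0<M , bf) (N , 0<N , bg) = M + N , ℚ.+-mono-< 0<M 0<N ,
      eventually-× (λ x → ∣p∣≤a⇒∣q∣≤b⇒∣p+q∣≤a+b (f x) (g x)) bf bg

    Bounded-* : ∀ {f g} → Bounded f → Bounded g → Bounded (λ x → f x * g x)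
    Bounded-* {f} {g} (M , 0<M , bf) (N , 0<N , bg) = M * N , 0<* 0<M 0<N ,
      eventually-× (λ x → ∣*∣-bound (f x) (g x) 0<M) bf bg

    ≃-+ : ∀ {f f′ g g′} → f ≃ f′ → g ≃ g′ → (λ x → f x + g x) ≃ (λ x → f′ x + g′ x)
    ≃-+ {f} {f′} {g} {g′} (mk≃ bf bf′ f≃f′) (mk≃ bg bg′ g≃g′) =
      mk≃ (Bounded-+ bf bg) (Bounded-+ bf′ bg′) λ ε 0<ε → eventually-×
        (λ x p q → subst₂ _≤_
          (cong ∣_∣ (solve 4 (λ f f′ g g′ → (f :- f′) :+ (g :- g′) := f :+ g :- (f′ :+ g′)) refl
            (f x) (f′ x) (g x) (g′ x)))
          (half+half ε) (∣p∣≤a⇒∣q∣≤b⇒∣p+q∣≤a+b (f x - f′ x) (g x - g′ x) p q))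
        (f≃f′ (½ * ε) (half-pos ε 0<ε)) (g≃g′ (½ * ε) (half-pos ε 0<ε))

    ≃-* : ∀ {f f′ g g′} → f ≃ f′ → g ≃ g′ → (λ x → f x * g x) ≃ (λ x → f′ x * g′ x)
    ≃-* {f} {f′} {g} {g′} (mk≃ bf@(M , 0<M , f≤M) bf′ f≃f′) (mk≃ bg bg′@(N , 0<N , g′≤N) g≃g′) =
      mk≃ (Bounded-* bf bg) (Bounded-* bf′ bg′) λ ε 0<ε →
        let δ , 0<δ , Mδ≡½ε = divide M (½ * ε) 0<M (half-pos ε 0<ε)
            η , 0<η , Nη≡½ε = divide N (½ * ε) 0<N (half-pos ε 0<ε)
        in eventually-×
          (λ x p q → subst₂ _≤_
            (cong ∣_∣ (solve 4 (λ f f′ g g′ → f :* (g :- g′) :+ g′ :* (f :- f′) := f :* g :- f′ :* g′) refl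
              (f x) (f′ x) (g x) (g′ x)))
            (trans (cong₂ _+_ Mδ≡½ε Nη≡½ε) (half+half ε))
            (∣p∣≤a⇒∣q∣≤b⇒∣p+q∣≤a+b (f x * (g x - g′ x)) (g′ x * (f x - f′ x)) p q))
          (eventually-× (λ x → ∣*∣-bound (f x) (g x - g′ x) 0<M) f≤M (g≃g′ δ 0<δ))
          (eventually-× (λ x → ∣*∣-bound (g′ x) (f x - f′ x) 0<N) g′≤N (f≃f′ η 0<η))

    ≃-sum : ∀ {n} {f g : X → Fin n → ℚ} → (∀ i → (λ x → f x i) ≃ (λ x → g x i)) →
      (λ x → sumℚ (f x)) ≃ (λ x → sumℚ (g x))
    ≃-sum {zero}  f≃g = ≃-const 0ℚ
    ≃-sum {suc n} f≃g = ≃-+ (f≃g zero) (≃-sum (f≃g ∘ suc))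

    ≃-prod : ∀ {n} {f g : X → Fin n → ℚ} → (∀ i → (λ x → f x i) ≃ (λ x → g x i)) →
      (λ x → prodℚ (f x)) ≃ (λ x → prodℚ (g x))
    ≃-prod {zero}  f≃g = ≃-const 1ℚ
    ≃-prod {suc n} f≃g = ≃-* (f≃g zero) (≃-prod (f≃g ∘ suc))

    ≃-det : ∀ {n} {A B : X → Mat n} → (∀ p q → (λ x → A x p q) ≃ (λ x → B x p q)) →
      (λ x → detℚ (A x)) ≃ (λ x → detℚ (B x))
    ≃-det {zero}  A≃B = ≃-const 1ℚ
    ≃-det {suc n} A≃B = ≃-sum λ j → ≃-* (≃-* (≃-const (sgn (toℕ j))) (A≃B zero j))
      (≃-det λ p q → A≃B (suc p) (punchIn j q))

    ≃-shift : ∀ {u v : X → Seq} → (∀ k → (λ x → u x k) ≃ (λ x → v x k)) →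
      ∀ k → (λ x → shift (u x) k) ≃ (λ x → shift (v x) k)
    ≃-shift u≃v zero    = ≃-const 0ℚ
    ≃-shift u≃v (suc k) = u≃v k

    ≃-psum : ∀ {u v : X → Seq} → (∀ k → (λ x → u x k) ≃ (λ x → v x k)) →
      ∀ k → (λ x → psum (u x) k) ≃ (λ x → psum (v x) k)
    ≃-psum u≃v zero    = u≃v zero
    ≃-psum u≃v (suc k) = ≃-+ (≃-psum u≃v k) (u≃v (suc k))

    ≃-tz : ∀ {u v : X → Seq} → (∀ k → (λ x → u x k) ≃ (λ x → v x k)) →
      ∀ i j → (λ x → tz (u x) i j) ≃ (λ x → tz (v x) i j)
    ≃-tz u≃v zero    j       = u≃v j
    ≃-tz u≃v (suc i) zero    = ≃-const 0ℚ
    ≃-tz u≃v (suc i) (suc j) = ≃-tz u≃v i j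

    eventually-all≤ : ∀ J {P : ℕ → X → Set} → (∀ j → Eventually (P j)) →
      Eventually λ x → ∀ j → j ℕ.≤ J → P j x
    eventually-all≤ zero    ev = eventually-× {Q = λ _ → ⊤} (λ { x p _ zero z≤n → p }) (ev 0) (whole , λ _ _ → tt)
    eventually-all≤ (suc J) {P} ev = eventually-× {Q = λ x → ∀ j → j ℕ.≤ J → P j x}
      (λ x p ps j j≤ → both x p ps j (ℕ.m≤n⇒m<n∨m≡n j≤))
      (ev (suc J)) (eventually-all≤ J ev)
      where
      both : ∀ x → P (suc J) x → (∀ j → j ℕ.≤ J → P j x) → ∀ j → j ℕ.< suc J ⊎ j ≡ suc J → P j x
      both x p ps j (inj₁ j<)   = ps j (ℕ.s≤s⁻¹ j<)
      both x p ps _ (inj₂ refl) = p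

  -- Polynomials with simple negative roots

  -- The value at - s of the polynomial with coefficients p 0 , ... , p d.
  ev : ℕ → Seq → ℚ → ℚ
  ev zero    p s = p 0
  ev (suc d) p s = p 0 - s * ev d (p ∘ suc) s

  -- The coefficients beyond degree d vanish.
  Supp : ℕ → Seq → Set
  Supp d p = ∀ j → d ℕ.< j → p j ≡ 0ℚ

  ev-cong : ∀ d {p q} s → (∀ j → p j ≡ q j) → ev d p s ≡ ev d q s
  ev-cong zero    s eq = eq 0
  ev-cong (suc d) s eq = cong₂ (λ x y → x - s * y) (eq 0) (ev-cong d s (eq ∘ suc))

  ev-linear : ∀ d r p q s → ev d (λ j → r * p j + q j) s ≡ r * ev d p s + ev d q s
  ev-linear zero    r p q s = refl
  ev-linear (suc d) r p q s = trans
    (cong (λ x → r * p 0 + q 0 - s * x) (ev-linear d r (p ∘ suc) (q ∘ suc) s))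
    (solve 6 (λ r p q s x y → r :* p :+ q :- s :* (r :* x :+ y) := r :* (p :- s :* x) :+ (q :- s :* y)) refl
      r (p 0) (q 0) s (ev d (p ∘ suc) s) (ev d (q ∘ suc) s))

  ev-drop-top : ∀ d {p} s → p (suc d) ≡ 0ℚ → ev (suc d) p s ≡ ev d p s
  ev-drop-top zero    {p} s top = trans (cong (λ x → p 0 - s * x) top)
    (solve 2 (λ p s → p :- s :* con 0ℚ := p) refl (p 0) s)
  ev-drop-top (suc d) {p} s top = cong (λ x → p 0 - s * x) (ev-drop-top d s top)

  ev-mulLin : ∀ d r {q} s → Supp d q → ev (suc d) (mulLin r q) s ≡ (r - s) * ev d q s
  ev-mulLin d r {q} s supp = trans (ev-linear (suc d) r q (shift q) s)
    (trans (cong (λ x → r * x + (0ℚ - s * ev d q s)) (ev-drop-top d s (supp (suc d) ℕ.≤-refl)))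
      (solve 3 (λ r s x → r :* x :+ (con 0ℚ :- s :* x) := (r :- s) :* x) refl r s (ev d q s)))

  ev-constant : ∀ d c s → ev d (constant c) s ≡ c
  ev-constant zero    c s = refl
  ev-constant (suc d) c s = trans (cong (λ x → c - s * x) (zeros d))
    (solve 2 (λ c s → c :- s :* con 0ℚ := c) refl c s)
    where
    zeros : ∀ d → ev d (λ _ → 0ℚ) s ≡ 0ℚ
    zeros zero    = refl
    zeros (suc d) = trans (cong (λ x → 0ℚ - s * x) (zeros d))
      (solve 1 (λ s → con 0ℚ :- s :* con 0ℚ := con 0ℚ) refl s)

  ev-0 : ∀ d p → ev d p 0ℚ ≡ p 0
  ev-0 zero    p = refl
  ev-0 (suc d) p = solve 2 (λ p x → p :- con 0ℚ :* x := p) refl (p 0) (ev d (p ∘ suc) 0ℚ)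

  -- The quotient of synthetic division by r + x.
  quot : ℕ → ℚ → Seq → Seq
  quot zero    r p j       = 0ℚ
  quot (suc d) r p zero    = ev d (p ∘ suc) r
  quot (suc d) r p (suc j) = quot d r (p ∘ suc) j

  supp-quot : ∀ d r p → Supp d (quot (suc d) r p)
  supp-quot d r p (suc j) d<j = above d (p ∘ suc) j (ℕ.s≤s⁻¹ d<j)
    where
    above : ∀ d p j → d ℕ.≤ j → quot d r p j ≡ 0ℚ
    above zero    p j       _   = refl
    above (suc d) p (suc j) d≤j = above d (p ∘ suc) j (ℕ.s≤s⁻¹ d≤j)

  quot-top : ∀ d r p → quot (suc d) r p d ≡ p (suc d)
  quot-top zero    r p = refl
  quot-top (suc d) r p = quot-top d r (p ∘ suc)

  division : ∀ d r {p} → Supp d p → ∀ j →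
    p j ≡ mulLin r (quot d r p) j + constant (ev d p r) j
  division zero    r {p} supp zero    = solve 2 (λ r x → x := r :* con 0ℚ :+ con 0ℚ :+ x) refl r (p 0)
  division (suc d) r {p} supp zero    =
    solve 3 (λ r x y → x := r :* y :+ con 0ℚ :+ (x :- r :* y)) refl r (p 0) (ev d (p ∘ suc) r)
  division zero    r {p} supp (suc j) = trans (supp (suc j) (s≤s z≤n))
    (solve 1 (λ r → con 0ℚ := r :* con 0ℚ :+ con 0ℚ :+ con 0ℚ) refl r)
  division (suc d) r {p} supp (suc j) =
    trans (division d r {p ∘ suc} (λ j d<j → supp (suc j) (s≤s d<j)) j) (carry j)
    where
    q = quot d r (p ∘ suc)
    v = ev d (p ∘ suc) r
    carry : ∀ j → r * q j + shift q j + constant v j ≡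
                  r * q j + quot (suc d) r p j + 0ℚ
    carry zero    = solve 3 (λ r q v → r :* q :+ con 0ℚ :+ v := r :* q :+ v :+ con 0ℚ) refl r (q 0) v
    carry (suc j) = refl

  ev-division : ∀ d r {p} s → Supp (suc d) p →
    ev (suc d) p s ≡ (r - s) * ev d (quot (suc d) r p) s + ev (suc d) p r
  ev-division d r {p} s supp = begin
    ev (suc d) p s
      ≡⟨ ev-cong (suc d) s (λ j → trans (division (suc d) r supp j)
           (cong (_+ constant h j) (sym (ℚ.*-identityˡ (mulLin r q j))))) ⟩
    ev (suc d) (λ j → 1ℚ * mulLin r q j + constant h j) s
      ≡⟨ ev-linear (suc d) 1ℚ (mulLin r q) (constant h) s ⟩
    1ℚ * ev (suc d) (mulLin r q) s + ev (suc d) (constant h) s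
      ≡⟨ cong₂ _+_ (trans (ℚ.*-identityˡ _) (ev-mulLin d r s (supp-quot d r p))) (ev-constant (suc d) h s) ⟩
    (r - s) * ev d q s + h ∎
    where
    open ≡-Reasoning
    q = quot (suc d) r p
    h = ev (suc d) p r

  -- The polynomial c (r₁ + x) ⋯ (r_d + x).
  prodLin : ∀ {d} → ℚ → Vec ℚ d → Seq
  prodLin c []       = constant c
  prodLin c (r ∷ rs) = mulLin r (prodLin c rs)

  supp-prodLin : ∀ {d} c (rs : Vec ℚ d) → Supp d (prodLin c rs)
  supp-prodLin c []       (suc j) _   = refl
  supp-prodLin c (r ∷ rs) (suc j) d<j = trans
    (cong₂ (λ x y → r * x + y) (supp-prodLin c rs (suc j) (ℕ.<-trans (ℕ.s≤s⁻¹ d<j) ℕ.≤-refl))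
                               (supp-prodLin c rs j (ℕ.s≤s⁻¹ d<j)))
    (solve 1 (λ r → r :* con 0ℚ :+ con 0ℚ := con 0ℚ) refl r)

  prodLin-top : ∀ {d} c (rs : Vec ℚ d) → prodLin c rs d ≡ c
  prodLin-top c []               = refl
  prodLin-top {suc d} c (r ∷ rs) = trans
    (cong₂ (λ x y → r * x + y) (supp-prodLin c rs (suc d) ℕ.≤-refl) (prodLin-top c rs))
    (solve 2 (λ r c → r :* con 0ℚ :+ c := c) refl r c)

  -- lo < s₁ < ... < sₙ.
  Inc : ∀ {n} → ℚ → Vec ℚ n → Set
  Inc lo []       = ⊤
  Inc lo (s ∷ ss) = lo < s × Inc s ss

  Inc-weaken : ∀ {n lo lo′} (ss : Vec ℚ n) → lo < lo′ → Inc lo′ ss → Inc lo ss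
  Inc-weaken []       lo<lo′ _               = tt
  Inc-weaken (s ∷ ss) lo<lo′ (lo′<s , s<ss) = ℚ.<-trans lo<lo′ lo′<s , s<ss

  Inc⇒All : ∀ {n lo} (ss : Vec ℚ n) → Inc lo ss → All (lo <_) ss
  Inc⇒All []       _              = []
  Inc⇒All (s ∷ ss) (lo<s , s<ss) = lo<s ∷ All.map (ℚ.<-trans lo<s) (Inc⇒All ss s<ss)

  -- On the points of the vector f takes nonzero values of alternating
  -- signs, the first of which is that of e.
  Alt : ∀ {n} → ℚ → (ℚ → ℚ) → Vec ℚ n → Set
  Alt e f []       = ⊤
  Alt e f (s ∷ ss) = 0ℚ < e * f s × Alt (- e) f ss

  alt-flip : ∀ {n} e {f g} {ss : Vec ℚ n} →
    All (λ s → ∀ e → 0ℚ < e * f s → 0ℚ < - e * g s) ss → Alt e f ss → Alt (- e) g ss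
  alt-flip e {ss = []}     []         _           = tt
  alt-flip e {ss = s ∷ ss} (fl ∷ fls) (0<ef , al) = fl e 0<ef , alt-flip (- e) fls al

  -- A sufficiently small constant can be subtracted without changing the signs.
  alt-perturb : ∀ {n} e f (ss : Vec ℚ n) → ∣ e ∣ ≤ 1ℚ → Alt e f ss →
    ∃ λ η → 0ℚ < η × ∀ g h → ∣ h ∣ ≤ η → (∀ s → f s ≡ g s + h) → Alt e g ss
  alt-perturb e f []       _   _            = 1ℚ , 0<1 , _
  alt-perturb e f (s ∷ ss) ∣e∣≤1 (0<ef , al)
    with η , 0<η , near ← alt-perturb (- e) f ss (subst (_≤ 1ℚ) (sym (ℚ.∣-p∣≡∣p∣ e)) ∣e∣≤1) al =
    (½ * (e * f s)) ⊓ η , min-pos (half-pos (e * f s) 0<ef) 0<η , λ g h h≤η f≗g+h →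
      positive-at g h (ℚ.≤-trans h≤η (ℚ.p⊓q≤p (½ * (e * f s)) η)) (f≗g+h s) ,
      near g h (ℚ.≤-trans h≤η (ℚ.p⊓q≤q (½ * (e * f s)) η)) f≗g+h
    where
    positive-at : ∀ g h → ∣ h ∣ ≤ ½ * (e * f s) → f s ≡ g s + h → 0ℚ < e * g s
    positive-at g h h≤ fs≡ = ℚ.<-≤-trans (half-pos (e * f s) 0<ef) (0≤q-p⇒p≤q (subst (0ℚ ≤_)
      (begin
        ½ * (e * f s) - e * h
          ≡⟨ cong (λ x → ½ * (e * x) - e * h) fs≡ ⟩
        ½ * (e * (g s + h)) - e * h
          ≡⟨ solve 3 (λ e g h → con ½ :* (e :* (g :+ h)) :- e :* h :=
                                e :* g :- con ½ :* (e :* (g :+ h))) refl e (g s) h ⟩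
        e * g s - ½ * (e * (g s + h))
          ≡⟨ cong (λ x → e * g s - ½ * (e * x)) fs≡ ⟨
        e * g s - ½ * (e * f s) ∎)
      (p≤q⇒0≤q-p (ℚ.≤-trans (p≤∣p∣ (e * h))
        (subst (∣ e * h ∣ ≤_) (ℚ.*-identityˡ (½ * (e * f s)))
          (∣*∣-bound e h 0<1 ∣e∣≤1 h≤))))))
      where open ≡-Reasoning

  -- A multiple of a difference r - s < 0 has the opposite sign.
  sign-flip : ∀ {r s x y} → r < s → x ≡ (r - s) * y → ∀ e → 0ℚ < e * y → 0ℚ < - e * x
  sign-flip {r} {s} {x} {y} r<s refl e 0<ey = subst (0ℚ <_)
    (solve 4 (λ r s e y → (s :- r) :* (e :* y) := :- e :* ((r :- s) :* y)) refl r s e y)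
    (0<* (p<q⇒0<q-p r<s) 0<ey)

  sign-unflip : ∀ {r s x y} → r < s → x ≡ (r - s) * y → ∀ e → 0ℚ < e * x → 0ℚ < - e * y
  sign-unflip {r} {s} {x} {y} r<s refl e 0<ex = ℚ.*-cancelˡ-<-nonNeg (s - r)
    {{nonNegative (ℚ.<⇒≤ (p<q⇒0<q-p r<s))}} (subst₂ _<_ (sym (ℚ.*-zeroʳ (s - r)))
      (solve 4 (λ r s e y → e :* ((r :- s) :* y) := (s :- r) :* (:- e :* y)) refl r s e y) 0<ex)

  -- An upper bound M and a Lipschitz constant K on the interval [- B , B].
  ev-bounds : ∀ d p {B} → 0ℚ < B → ∃ λ M → ∃ λ K → 0ℚ < M × 0ℚ < K ×
    (∀ s → ∣ s ∣ ≤ B → ∣ ev d p s ∣ ≤ M) ×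
    (∀ s t → ∣ s ∣ ≤ B → ∣ t ∣ ≤ B → ∣ ev d p s - ev d p t ∣ ≤ K * ∣ s - t ∣)
  ev-bounds zero p 0<B = ∣ p 0 ∣ + 1ℚ , 1ℚ , ℚ.+-mono-≤-< (ℚ.0≤∣p∣ (p 0)) 0<1 , 0<1 ,
    (λ _ _ → subst (_≤ ∣ p 0 ∣ + 1ℚ) (ℚ.+-identityʳ ∣ p 0 ∣) (ℚ.+-monoʳ-≤ ∣ p 0 ∣ (ℚ.<⇒≤ 0<1))) ,
    λ s t _ _ → close-refl {p 0} refl (0≤* (ℚ.<⇒≤ 0<1) (ℚ.0≤∣p∣ (s - t)))
  ev-bounds (suc d) p {B} 0<B with M , K , 0<M , 0<K , bounded , lipschitz ← ev-bounds d (p ∘ suc) 0<B =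
    ∣ p 0 ∣ + B * M , B * K + M , ℚ.+-mono-≤-< (ℚ.0≤∣p∣ (p 0)) (0<* 0<B 0<M) ,
    ℚ.+-mono-< (0<* 0<B 0<K) 0<M ,
    (λ s s≤B → ∣p∣≤a⇒∣q∣≤b⇒∣p+q∣≤a+b (p 0) (- (s * g s)) ℚ.≤-refl
      (subst (_≤ B * M) (sym (ℚ.∣-p∣≡∣p∣ (s * g s))) (∣*∣-bound s (g s) 0<B s≤B (bounded s s≤B)))) ,
    λ s t s≤B t≤B → begin
      ∣ p 0 - s * g s - (p 0 - t * g t) ∣
        ≡⟨ cong ∣_∣ (solve 5 (λ p s t x y → p :- s :* x :- (p :- t :* y) := :- (s :* (x :- y) :+ y :* (s :- t)))
             refl (p 0) s t (g s) (g t)) ⟩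
      ∣ - (s * (g s - g t) + g t * (s - t)) ∣
        ≡⟨ ℚ.∣-p∣≡∣p∣ (s * (g s - g t) + g t * (s - t)) ⟩
      ∣ s * (g s - g t) + g t * (s - t) ∣
        ≤⟨ ∣p∣≤a⇒∣q∣≤b⇒∣p+q∣≤a+b (s * (g s - g t)) (g t * (s - t))
             (∣*∣-bound s (g s - g t) 0<B s≤B (lipschitz s t s≤B t≤B))
             (∣*∣-bound (g t) (s - t) 0<M (bounded t t≤B) ℚ.≤-refl) ⟩
      B * (K * ∣ s - t ∣) + M * ∣ s - t ∣
        ≡⟨ solve 4 (λ B K M x → B :* (K :* x) :+ M :* x := (B :* K :+ M) :* x) refl B K M ∣ s - t ∣ ⟩
      (B * K + M) * ∣ s - t ∣ ∎
    where
    open ℚ.≤-Reasoning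
    g = ev d (p ∘ suc)

  -- A rational substitute for the intermediate value theorem: a sign change
  -- confines a point where the value is small.
  approximate-root : ∀ d p {a b} → 0ℚ ≤ a → a < b → 0ℚ < ev d p a → ev d p b < 0ℚ →
    ∀ η → 0ℚ < η → ∃ λ r → a ≤ r × r ≤ b × ∣ ev d p r ∣ ≤ η
  approximate-root d p {a} {b} 0≤a a<b 0<fa fb<0 η 0<η
    with M , K , 0<M , 0<K , _ , lipschitz ← ev-bounds d p (ℚ.≤-<-trans 0≤a a<b)
    with h , 0<h , Kh≡η ← divide K η 0<K 0<η
    with N , b-a≤Nh ← archimedean-step (p<q⇒0<q-p a<b) 0<h =
    walk N a 0≤a (ℚ.<⇒≤ a<b) (ℚ.<⇒≤ 0<fa) b-a≤Nh
    where
    f = ev d p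
    ∣s∣≤b : ∀ {s} → 0ℚ ≤ s → s ≤ b → ∣ s ∣ ≤ b
    ∣s∣≤b 0≤s s≤b = subst (_≤ b) (sym (ℚ.0≤p⇒∣p∣≡p 0≤s)) s≤b
    -- Over a step of length at most h the value changes by at most η.
    small : ∀ {s t} → 0ℚ ≤ s → s ≤ t → t ≤ b → t ≤ s + h → 0ℚ ≤ f s → f t < 0ℚ → ∣ f s ∣ ≤ η
    small {s} {t} 0≤s s≤t t≤b t≤s+h 0≤fs ft<0 = begin
      ∣ f s ∣            ≡⟨ ℚ.0≤p⇒∣p∣≡p 0≤fs ⟩
      f s                ≡⟨ ℚ.+-identityʳ (f s) ⟨
      f s + 0ℚ           ≤⟨ ℚ.+-monoʳ-≤ (f s) (ℚ.neg-antimono-≤ (ℚ.<⇒≤ ft<0)) ⟩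
      f s - f t          ≤⟨ p≤∣p∣ (f s - f t) ⟩
      ∣ f s - f t ∣      ≤⟨ lipschitz s t (∣s∣≤b 0≤s (ℚ.≤-trans s≤t t≤b)) (∣s∣≤b (ℚ.≤-trans 0≤s s≤t) t≤b) ⟩
      K * ∣ s - t ∣      ≤⟨ ℚ.*-monoˡ-≤-nonNeg K {{nonNegative (ℚ.<⇒≤ 0<K)}} distance ⟩
      K * h              ≡⟨ Kh≡η ⟩
      η                  ∎
      where
      open ℚ.≤-Reasoning
      distance : ∣ s - t ∣ ≤ h
      distance = begin
        ∣ s - t ∣     ≡⟨ cong ∣_∣ (solve 2 (λ s t → s :- t := :- (t :- s)) refl s t) ⟩
        ∣ - (t - s) ∣ ≡⟨ ℚ.∣-p∣≡∣p∣ (t - s) ⟩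
        ∣ t - s ∣     ≡⟨ ℚ.0≤p⇒∣p∣≡p (p≤q⇒0≤q-p s≤t) ⟩
        t - s         ≤⟨ ℚ.+-monoˡ-≤ (- s) t≤s+h ⟩
        s + h - s     ≡⟨ solve 2 (λ s h → s :+ h :- s := h) refl s h ⟩
        h             ∎
    step-up : ∀ s → s ≤ s + h
    step-up s = subst (_≤ s + h) (ℚ.+-identityʳ s) (ℚ.+-monoʳ-≤ s (ℚ.<⇒≤ 0<h))
    walk : ∀ N s → 0ℚ ≤ s → s ≤ b → 0ℚ ≤ f s → b - s ≤ ι N * h → ∃ λ r → s ≤ r × r ≤ b × ∣ f r ∣ ≤ η
    walk zero s 0≤s s≤b 0≤fs b-s≤0 = contradiction (ℚ.≤-<-trans (subst (λ x → 0ℚ ≤ f x) s≡b 0≤fs) fb<0)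
        (ℚ.<-irrefl refl)
      where
      s≡b : s ≡ b
      s≡b = ℚ.≤-antisym s≤b (0≤q-p⇒p≤q (subst (0ℚ ≤_) (solve 2 (λ s b → :- (b :- s) := s :- b) refl s b)
        (ℚ.neg-antimono-≤ (subst (b - s ≤_) (ℚ.*-zeroˡ h) b-s≤0))))
    walk (suc N) s 0≤s s≤b 0≤fs b-s≤Nh = step (b ℚ.≤? s + h) (0ℚ ℚ.≤? f (s + h))
      where
      remaining : b - (s + h) ≤ ι N * h
      remaining = subst₂ _≤_ (solve 3 (λ b s h → b :- s :+ :- h := b :- (s :+ h)) refl b s h)
        (solve 2 (λ n h → (con 1ℚ :+ n) :* h :- h := n :* h) refl (ι N) h)
        (ℚ.+-monoˡ-≤ (- h) b-s≤Nh)
      step : Dec (b ≤ s + h) → Dec (0ℚ ≤ f (s + h)) → ∃ λ r → s ≤ r × r ≤ b × ∣ f r ∣ ≤ η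
      step (yes b≤s+h) _ = s , ℚ.≤-refl , s≤b , small 0≤s s≤b ℚ.≤-refl b≤s+h 0≤fs fb<0
      step (no b≰s+h) (no 0≰f) = s , ℚ.≤-refl , s≤b ,
        small 0≤s (step-up s) (ℚ.<⇒≤ (ℚ.≰⇒> b≰s+h)) ℚ.≤-refl 0≤fs (ℚ.≰⇒> 0≰f)
      step (no b≰s+h) (yes 0≤f) =
        let r , s+h≤r , r≤b , fr≤η = walk N (s + h) (ℚ.≤-trans 0≤s (step-up s)) (ℚ.<⇒≤ (ℚ.≰⇒> b≰s+h)) 0≤f remaining
        in r , ℚ.≤-trans (step-up s) s+h≤r , r≤b , fr≤η

  -- A differential operator that preserves simple negative roots

  shift-close : ∀ {p q ε} → (∀ j → ∣ p j - q j ∣ ≤ ε) → ∀ j → ∣ shift p j - shift q j ∣ ≤ ε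
  shift-close close zero    = ℚ.≤-trans (ℚ.0≤∣p∣ _) (close zero)
  shift-close close (suc j) = close j

  mulLin-close : ∀ {p q ε r} → 0ℚ < r → (∀ j → ∣ p j - q j ∣ ≤ ε) →
    ∀ j → ∣ mulLin r p j - mulLin r q j ∣ ≤ (r + 1ℚ) * ε
  mulLin-close {p} {q} {ε} {r} 0<r close j = begin
    ∣ r * p j + shift p j - (r * q j + shift q j) ∣
      ≡⟨ cong ∣_∣ (solve 5 (λ r p q x y → r :* p :+ x :- (r :* q :+ y) := r :* (p :- q) :+ (x :- y))
           refl r (p j) (q j) (shift p j) (shift q j)) ⟩
    ∣ r * (p j - q j) + (shift p j - shift q j) ∣
      ≤⟨ ∣p∣≤a⇒∣q∣≤b⇒∣p+q∣≤a+b (r * (p j - q j)) (shift p j - shift q j)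
           (∣*∣-bound r (p j - q j) 0<r (ℚ.≤-reflexive (ℚ.0≤p⇒∣p∣≡p (ℚ.<⇒≤ 0<r))) (close j))
           (shift-close {p} {q} close j) ⟩
    r * ε + ε
      ≡⟨ solve 2 (λ r ε → r :* ε :+ ε := (r :+ con 1ℚ) :* ε) refl r ε ⟩
    (r + 1ℚ) * ε ∎
    where open ℚ.≤-Reasoning

  constant-close : ∀ {h η} → ∣ h ∣ ≤ η → ∀ j → ∣ constant h j ∣ ≤ η
  constant-close h≤η zero    = h≤η
  constant-close h≤η (suc j) = ℚ.≤-trans (ℚ.0≤∣p∣ _) h≤η

  -- A polynomial of degree n + 1 with positive leading coefficient and
  -- n sign changes on the nonpositive axis is a limit of products of
  -- n + 1 linear factors over ℚ.  To split off one factor, subtract the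
  -- small value at an approximate root between the first two points.
  alternating⇒near-prodLin : ∀ n {F c} s (ss : Vec ℚ n) → 0ℚ ≤ s → Supp (suc n) F →
    F (suc n) ≡ c → 0ℚ < c → Inc s ss → Alt 1ℚ (ev (suc n) F) (s ∷ ss) → ∀ ε → 0ℚ < ε →
    ∃ λ (rs : Vec ℚ (suc n)) → Inc s rs × ∀ j → ∣ F j - prodLin c rs j ∣ ≤ ε
  alternating⇒near-prodLin zero {F} {c} s [] 0≤s supp refl 0<c _ (0<Fs , _) ε 0<ε =
    split (divide c (F 0) 0<c 0<F0)
    where
    sc<F0 : s * c < F 0
    sc<F0 = 0<q-p⇒p<q (subst (0ℚ <_) (ℚ.*-identityˡ (F 0 - s * c)) 0<Fs)
    0<F0 : 0ℚ < F 0
    0<F0 = ℚ.≤-<-trans (0≤* 0≤s (ℚ.<⇒≤ 0<c)) sc<F0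
    split : (∃ λ r → 0ℚ < r × c * r ≡ F 0) →
      ∃ λ (rs : Vec ℚ 1) → Inc s rs × ∀ j → ∣ F j - prodLin c rs j ∣ ≤ ε
    split (r , 0<r , cr≡F0) = r ∷ [] ,
      (ℚ.*-cancelˡ-<-nonNeg c {{nonNegative (ℚ.<⇒≤ 0<c)}} (subst₂ _<_ (ℚ.*-comm s c) (sym cr≡F0) sc<F0) , tt) ,
      λ j → close-refl (exact j) (ℚ.<⇒≤ 0<ε)
      where
      exact : ∀ j → F j ≡ r * constant c j + shift (constant c) j
      exact 0 = trans (sym cr≡F0) (solve 2 (λ c r → c :* r := r :* c :+ con 0ℚ) refl c r)
      exact 1 = solve 2 (λ c r → c := r :* con 0ℚ :+ c) refl c r
      exact (suc (suc j)) = trans (supp (suc (suc j)) (s≤s (s≤s z≤n)))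
        (solve 1 (λ r → con 0ℚ := r :* con 0ℚ :+ con 0ℚ) refl r)
  alternating⇒near-prodLin (suc n) {F} {c} s₀ (s₁ ∷ ss) 0≤s₀ supp top 0<c (s₀<s₁ , s₁<ss) alt ε 0<ε =
    perturb (alt-perturb 1ℚ f (s₀ ∷ s₁ ∷ ss) ℚ.≤-refl alt)
    where
    f = ev (2 ℕ.+ n) F
    Goal : Set
    Goal = ∃ λ (rs : Vec ℚ (2 ℕ.+ n)) → Inc s₀ rs × ∀ j → ∣ F j - prodLin c rs j ∣ ≤ ε
    0<fs₀ : 0ℚ < f s₀
    0<fs₀ = subst (0ℚ <_) (ℚ.*-identityˡ (f s₀)) (proj₁ alt)
    fs₁<0 : f s₁ < 0ℚ
    fs₁<0 = 0<q-p⇒p<q (subst (0ℚ <_) (solve 1 (λ x → :- con 1ℚ :* x := con 0ℚ :- x) refl (f s₁))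
      (proj₁ (proj₂ alt)))

    split-off : ∀ r → s₀ ≤ r → r ≤ s₁ → ∣ f r ∣ ≤ ½ * ε →
      Alt 1ℚ (λ s → (r - s) * ev (suc n) (quot (2 ℕ.+ n) r F) s) (s₀ ∷ s₁ ∷ ss) → Goal
    split-off r s₀≤r r≤s₁ small (0<gs₀ , 0<-gs₁ , alt-ss) =
      approximate (divide (r + 1ℚ) (½ * ε) (ℚ.+-mono-< 0<r 0<1) (half-pos ε 0<ε))
      where
      G = quot (2 ℕ.+ n) r F
      g = ev (suc n) G
      r≢ : ∀ {s} e → 0ℚ < e * ((r - s) * g s) → r ≢ s
      r≢ {s} e 0< refl = ℚ.<-irrefl (sym (solve 3 (λ e s x → e :* ((s :- s) :* x) := con 0ℚ) refl e s (g s))) 0<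
      ≤∧≢⇒< : ∀ {p q} → p ≤ q → p ≢ q → p < q
      ≤∧≢⇒< p≤q p≢q = ℚ.≰⇒> λ q≤p → p≢q (ℚ.≤-antisym p≤q q≤p)
      s₀<r : s₀ < r
      s₀<r = ≤∧≢⇒< s₀≤r λ s₀≡r → r≢ {s₀} 1ℚ 0<gs₀ (sym s₀≡r)
      r<s₁ : r < s₁
      r<s₁ = ≤∧≢⇒< r≤s₁ (r≢ {s₁} (- 1ℚ) 0<-gs₁)
      0<r : 0ℚ < r
      0<r = ℚ.≤-<-trans 0≤s₀ s₀<r
      alt-g : Alt 1ℚ g (s₁ ∷ ss)
      alt-g = alt-flip (- 1ℚ) (All.map (λ r<s e → sign-unflip r<s refl e)
        (r<s₁ ∷ All.map (ℚ.<-trans r<s₁) (Inc⇒All ss s₁<ss))) (0<-gs₁ , alt-ss)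
      approximate : (∃ λ δ → 0ℚ < δ × (r + 1ℚ) * δ ≡ ½ * ε) → Goal
      approximate (δ , 0<δ , r+1δ≡½ε) =
        let rs , s₁<rs , close = alternating⇒near-prodLin n s₁ ss (ℚ.<⇒≤ (ℚ.<-trans 0<r r<s₁))
              (supp-quot (suc n) r F) (trans (quot-top (suc n) r F) top) 0<c s₁<ss alt-g δ 0<δ
        in r ∷ rs , (s₀<r , Inc-weaken rs r<s₁ s₁<rs) , λ j → begin
          ∣ F j - mulLin r (prodLin c rs) j ∣
            ≡⟨ cong (λ x → ∣ x - mulLin r (prodLin c rs) j ∣) (division (2 ℕ.+ n) r supp j) ⟩
          ∣ mulLin r G j + constant (f r) j - mulLin r (prodLin c rs) j ∣
            ≡⟨ cong ∣_∣ (solve 3 (λ x y z → x :+ y :- z := (x :- z) :+ y) refl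
                 (mulLin r G j) (constant (f r) j) (mulLin r (prodLin c rs) j)) ⟩
          ∣ (mulLin r G j - mulLin r (prodLin c rs) j) + constant (f r) j ∣
            ≤⟨ ∣p∣≤a⇒∣q∣≤b⇒∣p+q∣≤a+b (mulLin r G j - mulLin r (prodLin c rs) j) (constant (f r) j)
                 (mulLin-close {G} {prodLin c rs} 0<r close j) (constant-close {f r} small j) ⟩
          (r + 1ℚ) * δ + ½ * ε
            ≡⟨ trans (cong (_+ ½ * ε) r+1δ≡½ε) (half+half ε) ⟩
          ε ∎
        where
        open ℚ.≤-Reasoning

    perturb : (∃ λ η → 0ℚ < η × ∀ g h → ∣ h ∣ ≤ η → (∀ s → f s ≡ g s + h) → Alt 1ℚ g (s₀ ∷ s₁ ∷ ss)) → Goal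
    perturb (η , 0<η , near) =
      let r , s₀≤r , r≤s₁ , small = approximate-root (2 ℕ.+ n) F 0≤s₀ s₀<s₁ 0<fs₀ fs₁<0
            (η ⊓ (½ * ε)) (min-pos 0<η (half-pos ε 0<ε))
      in split-off r s₀≤r r≤s₁ (ℚ.≤-trans small (ℚ.p⊓q≤q η (½ * ε)))
           (near (λ s → (r - s) * ev (suc n) (quot (2 ℕ.+ n) r F) s) (f r)
             (ℚ.≤-trans small (ℚ.p⊓q≤p η (½ * ε))) (λ s → ev-division (suc n) r s supp))

  -- If p is the numerator P of P / (1 - x)^N and κ = N - β + 1, then Λ β κ p is the
  -- numerator of (x d/dx + β) (P / (1 - x)^N) over (1 - x)^(N + 1).
  Λ : ℚ → ℚ → Seq → Seq
  Λ β κ p j = (ι j + β) * p j + (κ - ι j) * shift p j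

  -- The product rule: Λ ((r + x) Q) = (r + x) Λ Q + (1 + r) x Q, where κ grows by 1
  -- with the degree.
  Λ-mulLin : ∀ β κ r q j → Λ β (κ + 1ℚ) (mulLin r q) j ≡ (1ℚ + r) * shift q j + mulLin r (Λ β κ q) j
  Λ-mulLin β κ r q zero =
    solve 4 (λ β κ r q → (con 0ℚ :+ β) :* (r :* q :+ con 0ℚ) :+ (κ :+ con 1ℚ :- con 0ℚ) :* con 0ℚ :=
        (con 1ℚ :+ r) :* con 0ℚ :+ (r :* ((con 0ℚ :+ β) :* q :+ (κ :- con 0ℚ) :* con 0ℚ) :+ con 0ℚ))
      refl β κ r (q 0)
  Λ-mulLin β κ r q (suc j) =
    solve 7 (λ j β κ r q₁ q q′ →
        (con 1ℚ :+ j :+ β) :* (r :* q₁ :+ q) :+ (κ :+ con 1ℚ :- (con 1ℚ :+ j)) :* (r :* q :+ q′) :=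
        (con 1ℚ :+ r) :* q :+ (r :* ((con 1ℚ :+ j :+ β) :* q₁ :+ (κ :- (con 1ℚ :+ j)) :* q) :+
                                      ((j :+ β) :* q :+ (κ :- j) :* q′)))
      refl (ι j) β κ r (q (suc j)) (q j) (shift q j)

  supp-Λ : ∀ d β κ {p} → Supp d p → Supp (suc d) (Λ β κ p)
  supp-Λ d β κ {p} supp (suc j) d<j = trans
    (cong₂ (λ x y → (1ℚ + ι j + β) * x + (κ - (1ℚ + ι j)) * y)
      (supp (suc j) (ℕ.<-trans (ℕ.s≤s⁻¹ d<j) ℕ.≤-refl)) (supp j (ℕ.s≤s⁻¹ d<j)))
    (solve 2 (λ x y → x :* con 0ℚ :+ y :* con 0ℚ := con 0ℚ) refl (1ℚ + ι j + β) (κ - (1ℚ + ι j)))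

  Λ-top : ∀ d β γ {p} → Supp d p → Λ β (γ + ι (suc d)) p (suc d) ≡ γ * p d
  Λ-top d β γ {p} supp = trans
    (cong (λ x → (1ℚ + ι d + β) * x + (γ + (1ℚ + ι d) - (1ℚ + ι d)) * p d) (supp (suc d) ℕ.≤-refl))
    (solve 4 (λ i β γ p → (con 1ℚ :+ i :+ β) :* con 0ℚ :+ (γ :+ (con 1ℚ :+ i) :- (con 1ℚ :+ i)) :* p :=
        γ :* p) refl (ι d) β γ (p d))

  ev-prodLin-pos : ∀ {d} c s (rs : Vec ℚ d) → 0ℚ < c → Inc s rs → 0ℚ < ev d (prodLin c rs) s
  ev-prodLin-pos c s []       0<c _             = 0<c
  ev-prodLin-pos {suc d} c s (r ∷ rs) 0<c (s<r , r<rs) =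
    subst (0ℚ <_) (sym (ev-mulLin d r s (supp-prodLin c rs)))
      (0<* (p<q⇒0<q-p s<r) (ev-prodLin-pos c s rs 0<c (Inc-weaken rs s<r r<rs)))

  ev-prodLin-root : ∀ {d} c (rs : Vec ℚ d) → All (λ s → ev d (prodLin c rs) s ≡ 0ℚ) rs
  ev-prodLin-root c [] = []
  ev-prodLin-root {suc d} c (r ∷ rs) =
    at r (solve 2 (λ r x → (r :- r) :* x := con 0ℚ) refl r (ev d (prodLin c rs) r)) ∷
    All.map (λ {s} eq → at s (trans (cong ((r - s) *_) eq) (ℚ.*-zeroʳ (r - s)))) (ev-prodLin-root c rs)
    where
    at : ∀ s → (r - s) * ev d (prodLin c rs) s ≡ 0ℚ → ev (suc d) (prodLin c (r ∷ rs)) s ≡ 0ℚ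
    at s eq = trans (ev-mulLin d r s (supp-prodLin c rs)) eq

  -- Evaluation of Λ ((r + x) Q) at - s, for Q = prodLin c rs.
  ev-Λ-prodLin : ∀ {d} β γ c r (rs : Vec ℚ d) s →
    ev (2 ℕ.+ d) (Λ β (γ + ι (2 ℕ.+ d)) (prodLin c (r ∷ rs))) s ≡
    (r - s) * ev (suc d) (Λ β (γ + ι (suc d)) (prodLin c rs)) s - (1ℚ + r) * s * ev d (prodLin c rs) s
  ev-Λ-prodLin {d} β γ c r rs s = begin
    ev (2 ℕ.+ d) (Λ β (γ + (1ℚ + ι (suc d))) (mulLin r q)) s
      ≡⟨ ev-cong (2 ℕ.+ d) s (λ j → trans
           (cong (λ κ → Λ β κ (mulLin r q) j)
             (solve 2 (λ γ i → γ :+ (con 1ℚ :+ i) := γ :+ i :+ con 1ℚ) refl γ (ι (suc d))))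
           (Λ-mulLin β κ r q j)) ⟩
    ev (2 ℕ.+ d) (λ j → (1ℚ + r) * shift q j + mulLin r (Λ β κ q) j) s
      ≡⟨ ev-linear (2 ℕ.+ d) (1ℚ + r) (shift q) (mulLin r (Λ β κ q)) s ⟩
    (1ℚ + r) * (0ℚ - s * ev (suc d) q s) + ev (2 ℕ.+ d) (mulLin r (Λ β κ q)) s
      ≡⟨ cong₂ (λ x y → (1ℚ + r) * (0ℚ - s * x) + y)
           (ev-drop-top d s (supp-prodLin c rs (suc d) ℕ.≤-refl))
           (ev-mulLin (suc d) r s (supp-Λ d β κ (supp-prodLin c rs))) ⟩
    (1ℚ + r) * (0ℚ - s * ev d q s) + (r - s) * ev (suc d) (Λ β κ q) s
      ≡⟨ solve 4 (λ r s x y → (con 1ℚ :+ r) :* (con 0ℚ :- s :* x) :+ (r :- s) :* y :=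
           (r :- s) :* y :- (con 1ℚ :+ r) :* s :* x) refl r s (ev d q s) (ev (suc d) (Λ β κ q) s) ⟩
    (r - s) * ev (suc d) (Λ β κ q) s - (1ℚ + r) * s * ev d q s ∎
    where
    open ≡-Reasoning
    q = prodLin c rs
    κ = γ + ι (suc d)

  -- At a root of the polynomial the operator acts as x (1 - x) d/dx, and
  -- the derivative alternates in sign along the simple roots.
  Λ-alternates : ∀ {d} β γ c lo (rs : Vec ℚ d) → 0ℚ < c → 0ℚ ≤ lo → Inc lo rs →
    Alt (- 1ℚ) (ev (suc d) (Λ β (γ + ι (suc d)) (prodLin c rs))) rs
  Λ-alternates β γ c lo [] _ _ _ = tt
  Λ-alternates {suc d} β γ c lo (r ∷ rs) 0<c 0≤lo (lo<r , r<rs) =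
    subst (0ℚ <_) (sym at-r) (0<* (0<* (ℚ.+-mono-< 0<1 0<r) 0<r) (ev-prodLin-pos c r rs 0<c r<rs)) ,
    alt-flip (- 1ℚ) (All.map (λ both → flips both) (All.zip (Inc⇒All rs r<rs , ev-prodLin-root c rs)))
      (Λ-alternates β γ c r rs 0<c (ℚ.<⇒≤ 0<r) r<rs)
    where
    0<r = ℚ.≤-<-trans 0≤lo lo<r
    q = prodLin c rs
    g = ev (suc d) (Λ β (γ + ι (suc d)) q)
    f = ev (2 ℕ.+ d) (Λ β (γ + ι (2 ℕ.+ d)) (mulLin r q))
    at-r : - 1ℚ * ev (2 ℕ.+ d) (Λ β (γ + ι (2 ℕ.+ d)) (mulLin r q)) r ≡ (1ℚ + r) * r * ev d q r
    at-r = trans (cong (- 1ℚ *_) (ev-Λ-prodLin β γ c r rs r))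
      (solve 3 (λ r x y → :- con 1ℚ :* ((r :- r) :* y :- (con 1ℚ :+ r) :* r :* x) := (con 1ℚ :+ r) :* r :* x)
        refl r (ev d q r) (g r))
    flips : ∀ {s} → r < s × ev d q s ≡ 0ℚ → ∀ e → 0ℚ < e * g s →
      0ℚ < - e * f s
    flips {s} (r<s , qs≡0) = sign-flip r<s (trans (ev-Λ-prodLin β γ c r rs s)
      (trans (cong (λ x → (r - s) * g s - (1ℚ + r) * s * x) qs≡0)
        (solve 3 (λ r s y → (r :- s) :* y :- (con 1ℚ :+ r) :* s :* con 0ℚ := (r :- s) :* y) refl r s (g s))))

  -- If P has simple negative roots, so has Λ P, up to an arbitrarily small error.
  Λ-near-prodLin : ∀ {d} β γ c (rs : Vec ℚ d) → 0ℚ < β → 0ℚ < γ → 0ℚ < c → Inc 0ℚ rs → ∀ ε → 0ℚ < ε →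
    ∃ λ (rs′ : Vec ℚ (suc d)) → Inc 0ℚ rs′ ×
      ∀ j → ∣ Λ β (γ + ι (suc d)) (prodLin c rs) j - prodLin (γ * c) rs′ j ∣ ≤ ε
  Λ-near-prodLin {d} β γ c rs 0<β 0<γ 0<c 0<rs = alternating⇒near-prodLin d 0ℚ rs ℚ.≤-refl
    (supp-Λ d β κ (supp-prodLin c rs))
    (trans (Λ-top d β γ (supp-prodLin c rs)) (cong (γ *_) (prodLin-top c rs)))
    (0<* 0<γ 0<c) 0<rs
    (subst (0ℚ <_) (sym at-0) (0<* 0<β (ev-prodLin-pos c 0ℚ rs 0<c 0<rs)) ,
     Λ-alternates β γ c 0ℚ rs 0<c ℚ.≤-refl 0<rs)
    where
    κ = γ + ι (suc d)
    q = prodLin c rs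
    at-0 : 1ℚ * ev (suc d) (Λ β κ q) 0ℚ ≡ β * ev d q 0ℚ
    at-0 = trans (cong (1ℚ *_) (ev-0 (suc d) (Λ β κ q)))
      (trans (solve 3 (λ β κ q → con 1ℚ :* ((con 0ℚ :+ β) :* q :+ (κ :- con 0ℚ) :* con 0ℚ) := β :* q) refl β κ (q 0))
        (cong (β *_) (sym (ev-0 d q))))

  -- Limits of polynomials with simple negative roots

  -- Pairs of a number tending to 0 and a sequence tending
  -- coefficientwise to p.
  module Nearby (p : Seq) where

    Base : Set
    Base = ℕ × ∃ λ δ → 0ℚ < δ

    _⊩_ : Base → ℚ × Seq → Set
    (J , δ , _) ⊩ (ε , q) = ∣ ε ∣ ≤ δ × ∀ j → j ℕ.≤ J → ∣ q j - p j ∣ ≤ δ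

    _∩_ : Base → Base → Base
    (J , δ , 0<δ) ∩ (J′ , δ′ , 0<δ′) = J ℕ.⊔ J′ , δ ⊓ δ′ , min-pos 0<δ 0<δ′

    ∩ˡ : ∀ {B C x} → (B ∩ C) ⊩ x → B ⊩ x
    ∩ˡ {J , δ , _} {J′ , δ′ , _} (ε≤ , q≤) =
      ℚ.≤-trans ε≤ (ℚ.p⊓q≤p δ δ′) ,
      λ j j≤J → ℚ.≤-trans (q≤ j (ℕ.≤-trans j≤J (ℕ.m≤m⊔n J J′))) (ℚ.p⊓q≤p δ δ′)

    ∩ʳ : ∀ {B C x} → (B ∩ C) ⊩ x → C ⊩ x
    ∩ʳ {J , δ , _} {J′ , δ′ , _} (ε≤ , q≤) =
      ℚ.≤-trans ε≤ (ℚ.p⊓q≤q δ δ′) ,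
      λ j j≤J → ℚ.≤-trans (q≤ j (ℕ.≤-trans j≤J (ℕ.m≤n⊔m J J′))) (ℚ.p⊓q≤q δ δ′)

    open Asymptotics {X = ℚ × Seq} _⊩_ (0 , 1ℚ , 0<1) _∩_
      (λ {B} {C} {x} → ∩ˡ {B} {C} {x}) (λ {B} {C} {x} → ∩ʳ {B} {C} {x}) public

    epsilon≃0 : proj₁ ≃ λ _ → 0ℚ
    epsilon≃0 = ≃-limit (boundedˡ (≃-const 0ℚ)) λ ε 0<ε → (0 , ε , 0<ε) , λ (η , _) x∈ →
      subst (λ y → ∣ y ∣ ≤ ε) (sym (ℚ.+-identityʳ η)) (proj₁ x∈)

    coefficient≃ : ∀ j → (λ (_ , q) → q j) ≃ λ _ → p j
    coefficient≃ j = ≃-limit (boundedˡ (≃-const (p j))) λ ε 0<ε → (j , ε , 0<ε) , λ _ x∈ → proj₂ x∈ j ℕ.≤-refl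

  -- Coefficientwise limits of polynomials of degree d with positive
  -- leading coefficient and simple negative rational roots.
  RootedLimit : ℕ → Seq → Set
  RootedLimit d p = ∀ J δ → 0ℚ < δ → ∃ λ c → ∃ λ (rs : Vec ℚ d) →
    0ℚ < c × Inc 0ℚ rs × ∀ j → j ℕ.≤ J → ∣ prodLin c rs j - p j ∣ ≤ δ

  -- Raising β and γ to β + ε and γ + ε makes them positive.
  rootedLimit-Λ : ∀ {d p β γ} → 0ℚ ≤ β → 0ℚ ≤ γ → RootedLimit d p → RootedLimit (suc d) (Λ β (γ + ι (suc d)) p)
  rootedLimit-Λ {d} {p} {β} {γ} 0≤β 0≤γ lim J δ 0<δ =
    (γ + η) * c , rs′ , 0<* (ℚ.+-mono-≤-< 0≤γ 0<η) 0<c , 0<rs′ , λ j j≤J → begin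
      ∣ prodLin ((γ + η) * c) rs′ j - Λ β κ p j ∣
        ≡⟨ cong ∣_∣ (solve 3 (λ x y z → x :- z := (y :- z) :+ :- (y :- x)) refl
             (prodLin ((γ + η) * c) rs′ j) (Λη j) (Λ β κ p j)) ⟩
      ∣ (Λη j - Λ β κ p j) + - (Λη j - prodLin ((γ + η) * c) rs′ j) ∣
        ≤⟨ ∣p∣≤a⇒∣q∣≤b⇒∣p+q∣≤a+b (Λη j - Λ β κ p j) (- (Λη j - prodLin ((γ + η) * c) rs′ j))
             (near (η , prodLin c rs) (ℚ.≤-reflexive (ℚ.0≤p⇒∣p∣≡p (ℚ.<⇒≤ 0<η)) , close) j j≤J)
             (subst (_≤ ½ * δ) (sym (ℚ.∣-p∣≡∣p∣ (Λη j - prodLin ((γ + η) * c) rs′ j))) (close′ j)) ⟩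
      ½ * δ + ½ * δ
        ≡⟨ half+half δ ⟩
      δ ∎
    where
    open ℚ.≤-Reasoning
    module N = Nearby p
    κ = γ + ι (suc d)
    perturbed : ∀ j → (λ (ε , q) → Λ (β + ε) ((γ + ε) + ι (suc d)) q j) N.≃ λ _ → Λ (β + 0ℚ) ((γ + 0ℚ) + ι (suc d)) p j
    perturbed j = N.≃-+
      (N.≃-* (N.≃-+ (N.≃-const (ι j)) (N.≃-+ (N.≃-const β) N.epsilon≃0)) (N.coefficient≃ j))
      (N.≃-* (N.≃-+ (N.≃-+ (N.≃-+ (N.≃-const γ) N.epsilon≃0) (N.≃-const (ι (suc d)))) (N.≃-const (- ι j)))
        (N.≃-shift {u = proj₂} {v = λ _ → p} N.coefficient≃ j))
    uniform : N.Eventually λ (ε , q) → ∀ j → j ℕ.≤ J → ∣ Λ (β + ε) ((γ + ε) + ι (suc d)) q j - Λ β κ p j ∣ ≤ ½ * δ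
    uniform = N.eventually-all≤ J λ j → N.close
      (N.≃-cong (λ _ → refl) (λ _ → cong₂ (λ b g → Λ b (g + ι (suc d)) p j) (ℚ.+-identityʳ β) (ℚ.+-identityʳ γ))
        (perturbed j)) (½ * δ) (half-pos δ 0<δ)
    J′ = proj₁ (proj₁ uniform)
    η = proj₁ (proj₂ (proj₁ uniform))
    0<η = proj₂ (proj₂ (proj₁ uniform))
    near = proj₂ uniform
    rooted = lim J′ η 0<η
    c = proj₁ rooted
    rs = proj₁ (proj₂ rooted)
    0<c = proj₁ (proj₂ (proj₂ rooted))
    0<rs = proj₁ (proj₂ (proj₂ (proj₂ rooted)))
    close = proj₂ (proj₂ (proj₂ (proj₂ rooted)))
    Λη : Seq
    Λη = Λ (β + η) ((γ + η) + ι (suc d)) (prodLin c rs)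
    rooted′ = Λ-near-prodLin (β + η) (γ + η) c rs (ℚ.+-mono-≤-< 0≤β 0<η) (ℚ.+-mono-≤-< 0≤γ 0<η) 0<c 0<rs
      (½ * δ) (half-pos δ 0<δ)
    rs′ = proj₁ rooted′
    0<rs′ = proj₁ (proj₂ rooted′)
    close′ = proj₂ (proj₂ rooted′)

  rootedLimit-constant : ∀ {c} → 0ℚ < c → RootedLimit 0 (constant c)
  rootedLimit-constant {c} 0<c J δ 0<δ = c , [] , 0<c , tt , λ j _ → close-refl {constant c j} refl (ℚ.<⇒≤ 0<δ)

  -- Division of the generating function by (1 - x)^n.
  psumⁿ : ℕ → Seq → Seq
  psumⁿ zero    u = u
  psumⁿ (suc n) u = psum (psumⁿ n u)

  tp-psumⁿ : ∀ n {u} → TPℚ u → TPℚ (psumⁿ n u)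
  tp-psumⁿ zero    tp = tp
  tp-psumⁿ (suc n) tp = tp-psum (tp-psumⁿ n tp)

  tp-prodLin : ∀ {d} {c lo} (rs : Vec ℚ d) → 0ℚ ≤ c → 0ℚ ≤ lo → Inc lo rs → TPℚ (prodLin c rs)
  tp-prodLin []       0≤c 0≤lo _ = tp-constant 0≤c
  tp-prodLin (r ∷ rs) 0≤c 0≤lo (lo<r , r<rs) =
    tp-mulLin 0≤r (tp-prodLin rs 0≤c 0≤r r<rs)
    where 0≤r = ℚ.≤-trans 0≤lo (ℚ.<⇒≤ lo<r)

  -- A limit of nonnegative numbers is nonnegative.
  nonneg-limit : ∀ x → (∀ ε → 0ℚ < ε → ∃ λ y → 0ℚ ≤ y × ∣ y - x ∣ ≤ ε) → 0ℚ ≤ x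
  nonneg-limit x lim = ℚ.≮⇒≥ λ x<0 →
    let 0<-x = subst (0ℚ <_) (ℚ.+-identityˡ (- x)) (p<q⇒0<q-p x<0)
        y , 0≤y , y-x≤ = lim (½ * - x) (half-pos (- x) 0<-x)
    in ℚ.<-irrefl {½ * - x} refl (begin-strict
      ½ * - x                ≡⟨ ℚ.+-identityʳ (½ * - x) ⟨
      ½ * - x + 0ℚ           <⟨ ℚ.+-monoʳ-< (½ * - x) (half-pos (- x) 0<-x) ⟩
      ½ * - x + ½ * - x      ≡⟨ half+half (- x) ⟩
      - x                    ≡⟨ ℚ.+-identityˡ (- x) ⟨
      0ℚ - x                 ≤⟨ ℚ.+-monoˡ-≤ (- x) 0≤y ⟩
      y - x                  ≤⟨ p≤∣p∣ (y - x) ⟩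
      ∣ y - x ∣              ≤⟨ y-x≤ ⟩
      ½ * - x                ∎)
    where open ℚ.≤-Reasoning

  -- Minors are polynomials in finitely many coefficients.
  tp-rootedLimit : ∀ {d p} n → RootedLimit d p → TPℚ (psumⁿ n p)
  tp-rootedLimit {d} {p} n lim rows cols rows< cols< = nonneg-limit (minorOf p) λ ε 0<ε →
    let (J , δ , 0<δ) , near = N.close continuous ε 0<ε
        c , rs , 0<c , 0<rs , close = lim J δ 0<δ
    in minorOf (prodLin c rs) ,
       tp-psumⁿ n (tp-prodLin rs (ℚ.<⇒≤ 0<c) ℚ.≤-refl 0<rs) rows cols rows< cols< ,
       near (0ℚ , prodLin c rs) (ℚ.<⇒≤ 0<δ , close)
    where
    module N = Nearby p
    minorOf : Seq → ℚ
    minorOf u = detℚ λ i j → tz (psumⁿ n u) (rows i) (cols j)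
    ≃-psumⁿ : ∀ n k → (λ (_ , q) → psumⁿ n q k) N.≃ λ _ → psumⁿ n p k
    ≃-psumⁿ zero    = N.coefficient≃
    ≃-psumⁿ (suc n) = N.≃-psum (≃-psumⁿ n)
    continuous : (λ (_ , q) → minorOf q) N.≃ λ _ → minorOf p
    continuous = N.≃-det λ i j → N.≃-tz (≃-psumⁿ n) (rows i) (cols j)

  -- Power series with denominator (1 - x)^n

  psum-cong : ∀ {u v} → (∀ k → u k ≡ v k) → ∀ k → psum u k ≡ psum v k
  psum-cong eq zero    = eq zero
  psum-cong eq (suc k) = cong₂ _+_ (psum-cong eq k) (eq (suc k))

  psumⁿ-cong : ∀ n {u v} → (∀ k → u k ≡ v k) → ∀ k → psumⁿ n u k ≡ psumⁿ n v k
  psumⁿ-cong zero    eq = eq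
  psumⁿ-cong (suc n) eq = psum-cong (psumⁿ-cong n eq)

  psumⁿ-+ : ∀ n u v k → psumⁿ n (λ j → u j + v j) k ≡ psumⁿ n u k + psumⁿ n v k
  psumⁿ-+ zero    u v k = refl
  psumⁿ-+ (suc n) u v k = trans (psum-cong (psumⁿ-+ n u v) k) (psum-+ k)
    where
    psum-+ : ∀ k → psum (λ j → psumⁿ n u j + psumⁿ n v j) k ≡ psum (psumⁿ n u) k + psum (psumⁿ n v) k
    psum-+ zero    = refl
    psum-+ (suc k) = trans (cong (_+ (psumⁿ n u (suc k) + psumⁿ n v (suc k))) (psum-+ k))
      (solve 4 (λ a b c d → a :+ b :+ (c :+ d) := a :+ c :+ (b :+ d)) refl
        (psum (psumⁿ n u) k) (psum (psumⁿ n v) k) (psumⁿ n u (suc k)) (psumⁿ n v (suc k)))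

  psumⁿ-scale : ∀ n c u k → psumⁿ n (λ j → c * u j) k ≡ c * psumⁿ n u k
  psumⁿ-scale zero    c u k = refl
  psumⁿ-scale (suc n) c u k = trans (psum-cong (psumⁿ-scale n c u) k) (psum-scale k)
    where
    psum-scale : ∀ k → psum (λ j → c * psumⁿ n u j) k ≡ c * psum (psumⁿ n u) k
    psum-scale zero    = refl
    psum-scale (suc k) = trans (cong (_+ c * psumⁿ n u (suc k)) (psum-scale k))
      (sym (ℚ.*-distribˡ-+ c (psum (psumⁿ n u) k) (psumⁿ n u (suc k))))

  psumⁿ-shift : ∀ n u k → psumⁿ n (shift u) k ≡ shift (psumⁿ n u) k
  psumⁿ-shift zero    u k = refl
  psumⁿ-shift (suc n) u k = trans (psum-cong (psumⁿ-shift n u) k) (psum-shift k)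
    where
    psum-shift : ∀ k → psum (shift (psumⁿ n u)) k ≡ shift (psum (psumⁿ n u)) k
    psum-shift zero          = refl
    psum-shift (suc zero)    = ℚ.+-identityˡ (psumⁿ n u 0)
    psum-shift (suc (suc k)) = cong (_+ psumⁿ n u (suc k)) (psum-shift (suc k))

  -- With θ = x d/dx: θ (v / (1 - x)) = θ v / (1 - x) + x v / (1 - x)^2.
  θ-psum : ∀ β v k → (ι k + β) * psum v k ≡ shift (psum (psum v)) k + psum (λ j → (ι j + β) * v j) k
  θ-psum β v zero    = sym (ℚ.+-identityˡ ((0ℚ + β) * v 0))
  θ-psum β v (suc k) = begin
    (1ℚ + ι k + β) * (psum v k + v (suc k))
      ≡⟨ solve 4 (λ i β s x → (con 1ℚ :+ i :+ β) :* (s :+ x) := (i :+ β) :* s :+ s :+ (con 1ℚ :+ i :+ β) :* x)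
           refl (ι k) β (psum v k) (v (suc k)) ⟩
    (ι k + β) * psum v k + psum v k + w (suc k)
      ≡⟨ cong (λ y → y + psum v k + w (suc k)) (θ-psum β v k) ⟩
    shift (psum (psum v)) k + psum w k + psum v k + w (suc k)
      ≡⟨ solve 4 (λ a b c d → a :+ b :+ c :+ d := (c :+ a) :+ (b :+ d)) refl
           (shift (psum (psum v)) k) (psum w k) (psum v k) (w (suc k)) ⟩
    psum v k + shift (psum (psum v)) k + (psum w k + w (suc k))
      ≡⟨ cong (_+ (psum w k + w (suc k))) (psum-rec (psum v) k) ⟨
    psum (psum v) k + psum w (suc k) ∎
    where
    open ≡-Reasoning
    w : Seq
    w j = (ι j + β) * v j

  -- (θ + β) (P / (1 - x)^n) = (Λ P) / (1 - x)^(n + 1).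
  θ-psumⁿ : ∀ n β p k → (ι k + β) * psumⁿ n p k ≡ psumⁿ (suc n) (Λ β (ι n - β + 1ℚ) p) k
  θ-psumⁿ zero β p zero =
    solve 2 (λ β p → (con 0ℚ :+ β) :* p := (con 0ℚ :+ β) :* p :+ (con 0ℚ :- β :+ con 1ℚ :- con 0ℚ) :* con 0ℚ)
      refl β (p 0)
  θ-psumⁿ zero β p (suc k) = trans
    (solve 4 (λ i β x y → (con 1ℚ :+ i :+ β) :* x := (i :+ β) :* y :+
        ((con 1ℚ :+ i :+ β) :* x :+ (con 0ℚ :- β :+ con 1ℚ :- (con 1ℚ :+ i)) :* y))
      refl (ι k) β (p (suc k)) (p k))
    (cong (_+ Λ β (0ℚ - β + 1ℚ) p (suc k)) (θ-psumⁿ zero β p k))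
  θ-psumⁿ (suc n) β p k = begin
    (ι k + β) * psum (psumⁿ n p) k
      ≡⟨ θ-psum β (psumⁿ n p) k ⟩
    shift (psumⁿ (2 ℕ.+ n) p) k + psum (λ j → (ι j + β) * psumⁿ n p j) k
      ≡⟨ cong₂ _+_ (sym (psumⁿ-shift (2 ℕ.+ n) p k)) (psum-cong (θ-psumⁿ n β p) k) ⟩
    psumⁿ (2 ℕ.+ n) (shift p) k + psumⁿ (2 ℕ.+ n) (Λ β (ι n - β + 1ℚ) p) k
      ≡⟨ psumⁿ-+ (2 ℕ.+ n) (shift p) (Λ β (ι n - β + 1ℚ) p) k ⟨
    psumⁿ (2 ℕ.+ n) (λ j → shift p j + Λ β (ι n - β + 1ℚ) p j) k
      ≡⟨ psumⁿ-cong (2 ℕ.+ n) (λ j →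
           solve 5 (λ i β n p q → q :+ ((i :+ β) :* p :+ (n :- β :+ con 1ℚ :- i) :* q) :=
               (i :+ β) :* p :+ (con 1ℚ :+ n :- β :+ con 1ℚ :- i) :* q)
             refl (ι j) β (ι n) (p j) (shift p j)) k ⟩
    psumⁿ (2 ℕ.+ n) (Λ β (1ℚ + ι n - β + 1ℚ) p) k ∎
    where open ≡-Reasoning

  -- (θ + n) (c / (1 - x)^n) = n c / (1 - x)^(n + 1).
  θ-psumⁿ-constant : ∀ n c k → (ι k + ι n) * psumⁿ n (constant c) k ≡ psumⁿ (suc n) (constant (ι n * c)) k
  θ-psumⁿ-constant n c k = trans (θ-psumⁿ n (ι n) (constant c) k) (psumⁿ-cong (suc n) numerator k)
    where
    numerator : ∀ j → Λ (ι n) (ι n - ι n + 1ℚ) (constant c) j ≡ constant (ι n * c) j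
    numerator 0 = solve 2 (λ n c → (con 0ℚ :+ n) :* c :+ (n :- n :+ con 1ℚ :- con 0ℚ) :* con 0ℚ := n :* c)
      refl (ι n) c
    numerator 1 = solve 2 (λ n c → (con 1ℚ :+ con 0ℚ :+ n) :* con 0ℚ :+ (n :- n :+ con 1ℚ :- (con 1ℚ :+ con 0ℚ)) :* c
      := con 0ℚ) refl (ι n) c
    numerator (suc (suc j)) = solve 2 (λ x y → x :* con 0ℚ :+ y :* con 0ℚ := con 0ℚ) refl
      (ι (suc (suc j)) + ι n) (ι n - ι n + 1ℚ - ι (suc (suc j)))

  pochhammer-suc : ∀ a k → pochhammer (suc a) k ℕ.* a ≡ pochhammer a k ℕ.* (a ℕ.+ k)
  pochhammer-suc a zero    = cong (1 ℕ.*_) (sym (ℕ.+-identityʳ a))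
  pochhammer-suc a (suc k) = begin
    pochhammer (suc a) k ℕ.* (suc a ℕ.+ k) ℕ.* a
      ≡⟨ S.solve 3 (λ p x a → p S.:* x S.:* a S.:= p S.:* a S.:* x) refl (pochhammer (suc a) k) (suc a ℕ.+ k) a ⟩
    pochhammer (suc a) k ℕ.* a ℕ.* (suc a ℕ.+ k)
      ≡⟨ cong₂ ℕ._*_ (pochhammer-suc a k) (sym (ℕ.+-suc a k)) ⟩
    pochhammer a k ℕ.* (a ℕ.+ k) ℕ.* (a ℕ.+ suc k) ∎
    where
    open ≡-Reasoning
    module S = ℕSolver.+-*-Solver

  -- The coefficients of (1 - x)^(- a) are (a)_k / k!.  The induction on a
  -- compares (k + a) (a)_k = a (a + 1)_k with θ-psumⁿ-constant.
  psumⁿ-pochhammer : ∀ a .{{_ : ℕ.NonZero a}} k → psumⁿ a (constant 1ℚ) k * ι (k !) ≡ ι (pochhammer a k)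
  psumⁿ-pochhammer 1 k = trans (cong₂ _*_ (ones k) (cong ι (sym (factorial k)))) (ℚ.*-identityˡ (ι (pochhammer 1 k)))
    where
    ones : ∀ k → psum (constant 1ℚ) k ≡ 1ℚ
    ones zero    = refl
    ones (suc k) = trans (ℚ.+-identityʳ (psum (constant 1ℚ) k)) (ones k)
    factorial : ∀ k → pochhammer 1 k ≡ k !
    factorial zero    = refl
    factorial (suc k) = trans (cong (ℕ._* suc k) (factorial k)) (ℕ.*-comm (k !) (suc k))
  psumⁿ-pochhammer (suc a@(suc _)) k = cancel (begin
    ι a * (psumⁿ (suc a) (constant 1ℚ) k * ι (k !))
      ≡⟨ ℚ.*-assoc (ι a) (psumⁿ (suc a) (constant 1ℚ) k) (ι (k !)) ⟨
    ι a * psumⁿ (suc a) (constant 1ℚ) k * ι (k !)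
      ≡⟨ cong (_* ι (k !)) (trans (sym (psumⁿ-scale (suc a) (ι a) (constant 1ℚ) k))
           (psumⁿ-cong (suc a) (λ { zero → refl ; (suc j) → ℚ.*-zeroʳ (ι a) }) k)) ⟩
    psumⁿ (suc a) (constant (ι a * 1ℚ)) k * ι (k !)
      ≡⟨ cong (_* ι (k !)) (θ-psumⁿ-constant a 1ℚ k) ⟨
    (ι k + ι a) * psumⁿ a (constant 1ℚ) k * ι (k !)
      ≡⟨ ℚ.*-assoc (ι k + ι a) (psumⁿ a (constant 1ℚ) k) (ι (k !)) ⟩
    (ι k + ι a) * (psumⁿ a (constant 1ℚ) k * ι (k !))
      ≡⟨ cong ((ι k + ι a) *_) (psumⁿ-pochhammer a k) ⟩
    (ι k + ι a) * ι (pochhammer a k)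
      ≡⟨ trans (ℚ.*-comm (ι k + ι a) (ι (pochhammer a k)))
           (cong (ι (pochhammer a k) *_) (trans (ℚ.+-comm (ι k) (ι a)) (sym (ι-+ a k)))) ⟩
    ι (pochhammer a k) * ι (a ℕ.+ k)
      ≡⟨ trans (sym (ι-* (pochhammer a k) (a ℕ.+ k)))
           (trans (cong ι (sym (pochhammer-suc a k))) (ι-* (pochhammer (suc a) k) a)) ⟩
    ι (pochhammer (suc a) k) * ι a
      ≡⟨ ℚ.*-comm (ι (pochhammer (suc a) k)) (ι a) ⟩
    ι a * ι (pochhammer (suc a) k) ∎)
    where
    open ≡-Reasoning
    cancel : ∀ {x y} → ι a * x ≡ ι a * y → x ≡ y
    cancel eq = ℚ.≤-antisym (ℚ.*-cancelˡ-≤-pos (ι a) {{positive (0<ι a)}} (ℚ.≤-reflexive eq))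
                            (ℚ.*-cancelˡ-≤-pos (ι a) {{positive (0<ι a)}} (ℚ.≤-reflexive (sym eq)))

  pochhammer/! : ∀ a .{{_ : ℕ.NonZero a}} k .{{_ : ℕ.NonZero (k !)}} →
    ⁺ pochhammer a k ÷ℤ k ! ≡ psumⁿ a (constant 1ℚ) k
  pochhammer/! a k = ℚ.≤-antisym (cancel (ℚ.≤-reflexive eq)) (cancel (ℚ.≤-reflexive (sym eq)))
    where
    eq : (⁺ pochhammer a k ÷ℤ k !) * ι (k !) ≡ psumⁿ a (constant 1ℚ) k * ι (k !)
    eq = trans (quotient-* (pochhammer a k) (k !)) (sym (psumⁿ-pochhammer a k))
    cancel : ∀ {x y} → x * ι (k !) ≤ y * ι (k !) → x ≤ y
    cancel = ℚ.*-cancelʳ-≤-pos (ι (k !)) {{positive (0<ι (k !))}}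

  -- Rational parameters

  -- With N = b + d each factor k + β acts on the numerator as Λ, where
  -- β ≥ 0 and γ = b - β ≥ 0.
  tp-product : ∀ {m} b d p (β : Fin m → ℚ) → RootedLimit d p → (∀ i → 0ℚ ≤ β i) → (∀ i → β i ≤ ι b) →
    TPℚ (λ k → psumⁿ (d ℕ.+ b) p k * prodℚ (λ i → ι k + β i))
  tp-product {zero}  b d p β lim 0≤β β≤b =
    tp-cong (λ k → sym (ℚ.*-identityʳ (psumⁿ (d ℕ.+ b) p k))) (tp-rootedLimit (d ℕ.+ b) lim)
  tp-product {suc m} b d p β lim 0≤β β≤b = tp-cong absorb
    (tp-product b (suc d) (Λ β₀ (γ + ι (suc d)) p) (β ∘ suc)
      (rootedLimit-Λ (0≤β zero) (p≤q⇒0≤q-p (β≤b zero)) lim) (0≤β ∘ suc) (β≤b ∘ suc))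
    where
    β₀ = β zero
    γ = ι b - β₀
    absorb : ∀ k → psumⁿ (suc d ℕ.+ b) (Λ β₀ (γ + ι (suc d)) p) k * prodℚ (λ i → ι k + β (suc i)) ≡
                   psumⁿ (d ℕ.+ b) p k * prodℚ (λ i → ι k + β i)
    absorb k = begin
      psumⁿ (suc d ℕ.+ b) (Λ β₀ (γ + ι (suc d)) p) k * Π
        ≡⟨ cong (λ κ → psumⁿ (suc d ℕ.+ b) (Λ β₀ κ p) k * Π)
             (trans (solve 3 (λ b β d → b :- β :+ (con 1ℚ :+ d) := d :+ b :- β :+ con 1ℚ) refl (ι b) β₀ (ι d))
               (cong (λ x → x - β₀ + 1ℚ) (sym (ι-+ d b)))) ⟩
      psumⁿ (suc d ℕ.+ b) (Λ β₀ (ι (d ℕ.+ b) - β₀ + 1ℚ) p) k * Π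
        ≡⟨ cong (_* Π) (θ-psumⁿ (d ℕ.+ b) β₀ p k) ⟨
      (ι k + β₀) * psumⁿ (d ℕ.+ b) p k * Π
        ≡⟨ solve 3 (λ x y z → x :* y :* z := y :* (x :* z)) refl (ι k + β₀) (psumⁿ (d ℕ.+ b) p k) Π ⟩
      psumⁿ (d ℕ.+ b) p k * ((ι k + β₀) * Π) ∎
      where
      open ≡-Reasoning
      Π = prodℚ (λ i → ι k + β (suc i))

open Rational
open import Defs

-- Cauchy sequences

seq-sum : ∀ {m} (f : Vector ℝ m) n → seq (sum f) n ≡ sumℚ (λ i → seq (f i) n)
seq-sum {zero}  f n = refl
seq-sum {suc m} f n = cong (seq (f zero) n ℚ.+_) (seq-sum (f ∘ suc) n)

seq-product : ∀ {m} (f : Vector ℝ m) n → seq (product f) n ≡ prodℚ (λ i → seq (f i) n)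
seq-product {zero}  f n = refl
seq-product {suc m} f n = cong (seq (f zero) n ℚ.*_) (seq-product (f ∘ suc) n)

seq-sgn : ∀ j n → seq ((- 1ℝ) ^ j) n ≡ sgn j
seq-sgn zero    n = refl
seq-sgn (suc j) n = cong (ℚ.- 1ℚ ℚ.*_) (seq-sgn j n)

seq-det : ∀ {m} (A : Matrix m) n → seq (det A) n ≡ detℚ (λ p q → seq (A p q) n)
seq-det {zero}  A n = refl
seq-det {suc m} A n = trans
  (seq-sum (λ j → (- 1ℝ) ^ toℕ j * A zero j * det (λ p q → A (suc p) (punchIn j q))) n)
  (sumℚ-cong λ j → cong₂ (λ s d → s ℚ.* seq (A zero j) n ℚ.* d)
    (seq-sgn (toℕ j) n) (seq-det (λ p q → A (suc p) (punchIn j q)) n))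

seq-toeplitz : ∀ u i j n → seq (toeplitz u i j) n ≡ tz (λ k → seq (u k) n) i j
seq-toeplitz u zero    j       n = refl
seq-toeplitz u (suc i) zero    n = refl
seq-toeplitz u (suc i) (suc j) n =
  trans (cong (λ z → seq (extendByZero u z) n) (ℤ.[1+m]⊖[1+n]≡m⊖n j i)) (seq-toeplitz u i j n)

seq-term : ∀ a .{{_ : NonZero a}} {m} (α : Vector ℝ m) k n →
  seq (term a α k) n ≡ psumⁿ a (constant 1ℚ) k ℚ.* prodℚ (λ i → ι k ℚ.+ seq (α i) n)
seq-term a α k n = cong₂ ℚ._*_ (pochhammer/! a k {{k ℕ.!≢0}})
  (trans (seq-product (λ i → fromℕ k + α i) n)
    (prodℚ-cong λ i → cong (ℚ._+ seq (α i) n) (sym (ι≡n/1 k))))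

-- Asymptotics of sequences as the index tends to infinity.
open Asymptotics {X = ℕ} ℕ._≤_ 0 ℕ._⊔_
  (λ {M} {N} → ℕ.m⊔n≤o⇒m≤o M N) (λ {M} {N} → ℕ.m⊔n≤o⇒n≤o M N)

≃-trans : ∀ {f g h} → f ≃ g → g ≃ h → f ≃ h
≃-trans {f} {g} {h} f≃g g≃h = mk≃ (boundedˡ f≃g) (boundedʳ g≃h) λ ε 0<ε → eventually-×
  (λ n p q → subst₂ ℚ._≤_
    (cong ∣_∣ (solve 3 (λ x y z → (x :- y) :+ (y :- z) := x :- z) refl (f n) (g n) (h n)))
    (half+half ε) (∣p∣≤a⇒∣q∣≤b⇒∣p+q∣≤a+b (f n ℚ.- g n) (g n ℚ.- h n) p q))
  (close f≃g (½ ℚ.* ε) (half-pos ε 0<ε)) (close g≃h (½ ℚ.* ε) (half-pos ε 0<ε))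

seq-bounded : ∀ x → Bounded (seq x)
seq-bounded x = eventually-bounded (cauchy x)

-- If y - x at a late index N were below - ε / 2, it would stay below - ε / 4,
-- so that y < x.
≤⇒eventually : ∀ {x y} → x ≤ y → ∀ ε → 0ℚ ℚ.< ε → Eventually λ n → seq x n ℚ.≤ seq y n ℚ.+ ε
≤⇒eventually {x} {y} x≤y ε 0<ε
  with N , near ← +-cauchy (seq y) (λ n → ℚ.- seq x n) (cauchy y) (neg-cauchy (seq x) (cauchy x))
         (½ ℚ.* (½ ℚ.* ε)) (half-pos (½ ℚ.* ε) (half-pos ε 0<ε))
  with ℚ.- (½ ℚ.* ε) ℚ.≤? seq y N ℚ.- seq x N
... | yes le = N , λ n N≤n → 0≤q-p⇒p≤q (subst (0ℚ ℚ.≤_)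
        (solve 5 (λ x y xN yN ε → (yN :- xN :- (:- (con ½ :* ε))) :+
            ((con ½ :* (con ½ :* ε)) :- ((yN :- xN) :- (y :- x))) :+ con ½ :* (con ½ :* ε) := y :+ ε :- x)
          refl (seq x n) (seq y n) (seq x N) (seq y N) ε)
        (0≤+ (0≤+ (p≤q⇒0≤q-p le) (p≤q⇒0≤q-p (ℚ.≤-trans (p≤∣p∣ _) (near N n ℕ.≤-refl N≤n))))
          (ℚ.<⇒≤ (half-pos (½ ℚ.* ε) (half-pos ε 0<ε)))))
... | no nle = contradiction
        (½ ℚ.* (½ ℚ.* ε) , half-pos (½ ℚ.* ε) (half-pos ε 0<ε) , N , λ n N≤n → 0≤q-p⇒p≤q (subst (0ℚ ℚ.≤_)
          (solve 5 (λ x y xN yN ε → (:- (con ½ :* ε) :- (yN :- xN)) :+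
              ((con ½ :* (con ½ :* ε)) :- ((y :- x) :- (yN :- xN))) := x :- (y :+ con ½ :* (con ½ :* ε)))
            refl (seq x n) (seq y n) (seq x N) (seq y N) ε)
          (0≤+ (p≤q⇒0≤q-p (ℚ.<⇒≤ (ℚ.≰⇒> nle)))
            (p≤q⇒0≤q-p (ℚ.≤-trans (p≤∣p∣ _) (near n N N≤n ℕ.≤-refl))))))
        x≤y

<-≤-trans : ∀ {x y z} → x < y → y ≤ z → x < z
<-≤-trans {x} {y} {z} (ε , 0<ε , x+ε≤y) y≤z = ½ ℚ.* ε , half-pos ε 0<ε , eventually-×
  (λ n p q → 0≤q-p⇒p≤q (subst (0ℚ ℚ.≤_)
    (solve 4 (λ x y z ε → (y :- (x :+ ε)) :+ (z :+ con ½ :* ε :- y) := z :- (x :+ con ½ :* ε))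
      refl (seq x n) (seq y n) (seq z n) ε)
    (0≤+ (p≤q⇒0≤q-p p) (p≤q⇒0≤q-p q))))
  x+ε≤y (≤⇒eventually {y} {z} y≤z (½ ℚ.* ε) (half-pos ε 0<ε))

≤-trans : ∀ {x y z} → x ≤ y → y ≤ z → x ≤ z
≤-trans {x} {y} {z} x≤y y≤z z<x = y≤z (<-≤-trans {z} {x} {y} z<x x≤y)

-- The projection of ℚ onto the interval [0 , B].  The approximations of a
-- parameter in this interval may lie outside it.
clamp : ℚ → ℚ → ℚ
clamp B x = 0ℚ ℚ.⊔ (x ℚ.⊓ B)

0≤clamp : ∀ B x → 0ℚ ℚ.≤ clamp B x
0≤clamp B x = ℚ.p≤p⊔q 0ℚ (x ℚ.⊓ B)

clamp≤ : ∀ {B} x → 0ℚ ℚ.≤ B → clamp B x ℚ.≤ B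
clamp≤ {B} x 0≤B = ℚ.⊔-lub 0≤B (ℚ.p⊓q≤q x B)

clamp-close : ∀ {B x ε} → 0ℚ ℚ.≤ B → 0ℚ ℚ.≤ ε → 0ℚ ℚ.≤ x ℚ.+ ε → x ℚ.≤ B ℚ.+ ε → ∣ clamp B x ℚ.- x ∣ ℚ.≤ ε
clamp-close {B} {x} {ε} 0≤B 0≤ε 0≤x+ε x≤B+ε with ℚ.≤-total x 0ℚ | ℚ.≤-total x B
... | inj₁ x≤0 | _ = subst (λ c → ∣ c ℚ.- x ∣ ℚ.≤ ε)
        (sym (trans (cong (0ℚ ℚ.⊔_) (ℚ.p≤q⇒p⊓q≡p (ℚ.≤-trans x≤0 0≤B))) (ℚ.p≥q⇒p⊔q≡p x≤0)))
        (ℚ.≤-trans (ℚ.≤-reflexive (ℚ.0≤p⇒∣p∣≡p (p≤q⇒0≤q-p x≤0))) (0≤q-p⇒p≤q (subst (0ℚ ℚ.≤_)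
          (solve 2 (λ x ε → x :+ ε := ε :- (con 0ℚ :- x)) refl x ε) 0≤x+ε)))
... | inj₂ 0≤x | inj₁ x≤B = close-refl
        (trans (cong (0ℚ ℚ.⊔_) (ℚ.p≤q⇒p⊓q≡p x≤B)) (ℚ.p≤q⇒p⊔q≡q 0≤x)) 0≤ε
... | inj₂ 0≤x | inj₂ B≤x = subst (λ c → ∣ c ℚ.- x ∣ ℚ.≤ ε)
        (sym (trans (cong (0ℚ ℚ.⊔_) (ℚ.p≥q⇒p⊓q≡q B≤x)) (ℚ.p≤q⇒p⊔q≡q 0≤B)))
        (subst (ℚ._≤ ε) (trans (sym (ℚ.∣-p∣≡∣p∣ (x ℚ.- B))) (cong ∣_∣ (solve 2 (λ x B → :- (x :- B) := B :- x) refl x B)))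
          (ℚ.≤-trans (ℚ.≤-reflexive (ℚ.0≤p⇒∣p∣≡p (p≤q⇒0≤q-p B≤x))) (0≤q-p⇒p≤q (subst (0ℚ ℚ.≤_)
            (solve 3 (λ x B ε → B :+ ε :- x := ε :- (x :- B)) refl x B ε) (p≤q⇒0≤q-p x≤B+ε)))))

clamp≃ : ∀ b {x} → 0ℝ ≤ x → x ≤ fromℕ b → seq x ≃ λ n → clamp (ι b) (seq x n)
clamp≃ b {x} 0≤x x≤b = ≃-sym (≃-limit (seq-bounded x) λ ε 0<ε → eventually-×
  (λ n p q → clamp-close (0≤ι b) (ℚ.<⇒≤ 0<ε) p (subst (λ B → seq x n ℚ.≤ B ℚ.+ ε) (sym (ι≡n/1 b)) q))
  (≤⇒eventually {0ℝ} {x} 0≤x ε 0<ε) (≤⇒eventually {x} {fromℕ b} x≤b ε 0<ε))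
  where
  ≃-sym : ∀ {f g} → f ≃ g → g ≃ f
  ≃-sym {f} {g} f≃g = mk≃ (boundedʳ f≃g) (boundedˡ f≃g) λ ε 0<ε →
    let N , near = close f≃g ε 0<ε in N , λ n N≤n → subst (ℚ._≤ ε)
      (trans (sym (ℚ.∣-p∣≡∣p∣ (f n ℚ.- g n))) (cong ∣_∣ (solve 2 (λ x y → :- (x :- y) := y :- x) refl (f n) (g n))))
      (near n N≤n)

≃-nonneg : ∀ {f g} → f ≃ g → (∀ n → 0ℚ ℚ.≤ g n) → ∀ ε → 0ℚ ℚ.< ε → ¬ Eventually λ n → f n ℚ.+ ε ℚ.≤ 0ℚ
≃-nonneg {f} {g} f≃g 0≤g ε 0<ε f<0
  with N , bad ← eventually-× (λ n → _,_) f<0 (close f≃g (½ ℚ.* ε) (half-pos ε 0<ε))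
  with f+ε≤0 , near ← bad N ℕ.≤-refl = ℚ.<-irrefl refl (begin-strict
    0ℚ                                       <⟨ half-pos ε 0<ε ⟩
    ½ ℚ.* ε                                  ≡⟨ ℚ.+-identityˡ (½ ℚ.* ε) ⟨
    0ℚ ℚ.+ ½ ℚ.* ε                           ≤⟨ ℚ.+-monoˡ-≤ (½ ℚ.* ε) (p≤q⇒0≤q-p (ℚ.≤-trans (p≤∣p∣ _) near′)) ⟩
    ½ ℚ.* ε ℚ.- (g N ℚ.- f N) ℚ.+ ½ ℚ.* ε
      ≡⟨ solve 3 (λ f g ε → con ½ :* ε :- (g :- f) :+ con ½ :* ε := f :+ ε :- g) refl (f N) (g N) ε ⟩
    f N ℚ.+ ε ℚ.- g N                        ≤⟨ ℚ.+-mono-≤ f+ε≤0 (ℚ.neg-antimono-≤ (0≤g N)) ⟩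
    0ℚ ∎)
  where
  open ℚ.≤-Reasoning
  near′ : ∣ g N ℚ.- f N ∣ ℚ.≤ ½ ℚ.* ε
  near′ = subst (ℚ._≤ ½ ℚ.* ε) (trans (sym (ℚ.∣-p∣≡∣p∣ (f N ℚ.- g N)))
    (cong ∣_∣ (solve 2 (λ x y → :- (x :- y) := y :- x) refl (f N) (g N)))) near

fromℕ-injective : ∀ {x m n} → x ≈ fromℕ m → x ≈ fromℕ n → ¬ m ℕ.< n
fromℕ-injective {x} {m} {n} x≈m x≈n m<n
  with N , far ← eventually-× (λ k → _,_) 
      (x≈m (½ ℚ.* ½) (half-pos ½ (ℚ.positive⁻¹ ½))) (x≈n (½ ℚ.* ½) (half-pos ½ (ℚ.positive⁻¹ ½)))
  with near-m , near-n ← far N ℕ.≤-refl = ℚ.<-irrefl refl (begin-strict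
    1ℚ                                       ≤⟨ 0≤q-p⇒p≤q (subst (0ℚ ℚ.≤_)
                                                  (solve 2 (λ m n → n :- (con 1ℚ :+ m) := n :- m :- con 1ℚ) refl (ι m) (ι n))
                                                  (p≤q⇒0≤q-p (ι-mono-≤ m<n))) ⟩
    ι n ℚ.- ι m                              ≡⟨ solve 3 (λ x m n → n :- m := (x :- m) :+ :- (x :- n)) refl (seq x N) (ι m) (ι n) ⟩
    (seq x N ℚ.- ι m) ℚ.+ ℚ.- (seq x N ℚ.- ι n)
      ≤⟨ p≤∣p∣ _ ⟩
    ∣ (seq x N ℚ.- ι m) ℚ.+ ℚ.- (seq x N ℚ.- ι n) ∣
      ≤⟨ ∣p∣≤a⇒∣q∣≤b⇒∣p+q∣≤a+b (seq x N ℚ.- ι m) (ℚ.- (seq x N ℚ.- ι n))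
           (subst (λ y → ∣ seq x N ℚ.- y ∣ ℚ.≤ ½ ℚ.* ½) (sym (ι≡n/1 m)) near-m)
           (subst (ℚ._≤ ½ ℚ.* ½) (sym (ℚ.∣-p∣≡∣p∣ (seq x N ℚ.- ι n)))
             (subst (λ y → ∣ seq x N ℚ.- y ∣ ℚ.≤ ½ ℚ.* ½) (sym (ι≡n/1 n)) near-n)) ⟩
    ½ ℚ.* ½ ℚ.+ ½ ℚ.* ½                      ≡⟨ half+half ½ ⟩
    ½                                        <⟨ toWitness {a? = ½ ℚ.<? 1ℚ} _ ⟩
    1ℚ ∎)
  where
  open ℚ.≤-Reasoning

-- The minor of the Toeplitz matrix of u with the given rows and columns.
Minor : ∀ {n} → (Fin n → ℕ) → (Fin n → ℕ) → Seq → ℚ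
Minor rows cols u = detℚ λ p q → tz u (rows p) (cols q)

-- Real parameters

-- U n is asymptotic to the sequence for the n-th approximations of the parameters.
-- Integral parameters b, b + 1, ... are absorbed one by one in the power
-- of 1 - x; then the remaining ones lie in [0 , b].
minor-not-negative : ∀ {m} b .{{_ : NonZero b}} c → 0ℚ ℚ.< c → (α : Vector ℝ m) →
  (∀ i → 0ℝ ≤ α i) → (∀ n → b ℕ.≤ n → ∀ j → fromℕ n < α j → ∃ λ i → α i ≈ fromℕ n) →
  ∀ (U : ℕ → Seq) →
  (∀ k → (λ n → U n k) ≃ λ n → psumⁿ b (constant c) k ℚ.* prodℚ (λ i → ι k ℚ.+ seq (α i) n)) →
  ∀ {d} (rows cols : Fin d → ℕ) → StrictlyIncreasing rows → StrictlyIncreasing cols →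
  ∀ ε → 0ℚ ℚ.< ε → ¬ Eventually λ n → Minor rows cols (U n) ℚ.+ ε ℚ.≤ 0ℚ
minor-not-negative {m} b c 0<c α 0≤α integers U U≃ rows cols rows< cols< ε 0<ε negative =
  -- Whether a parameter exceeds b is undecidable, but to refute a statement it
  -- suffices to refute it in either case.
  small (λ j b<αj → large m α 0≤α integers U≃ j b<αj)
  where
  small : ¬ (∀ j → α j ≤ fromℕ b)
  small α≤b = ≃-nonneg (≃-det λ p q → ≃-tz U≃clamped (rows p) (cols q))
    (λ n → tp-product b 0 (constant c) (λ i → clamp (ι b) (seq (α i) n)) (rootedLimit-constant 0<c)
      (λ i → 0≤clamp (ι b) (seq (α i) n)) (λ i → clamp≤ (seq (α i) n) (0≤ι b)) rows cols rows< cols<)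
    ε 0<ε negative
    where
    U≃clamped : ∀ k → (λ n → U n k) ≃
      λ n → psumⁿ b (constant c) k ℚ.* prodℚ (λ i → ι k ℚ.+ clamp (ι b) (seq (α i) n))
    U≃clamped k = ≃-trans (U≃ k) (≃-* (≃-const (psumⁿ b (constant c) k))
      (≃-prod λ i → ≃-+ (≃-const (ι k)) (clamp≃ b {α i} (0≤α i) (α≤b i))))

  large : ∀ m (α : Vector ℝ m) → (∀ i → 0ℝ ≤ α i) →
    (∀ n → b ℕ.≤ n → ∀ j → fromℕ n < α j → ∃ λ i → α i ≈ fromℕ n) →
    (∀ k → (λ n → U n k) ≃ λ n → psumⁿ b (constant c) k ℚ.* prodℚ (λ i → ι k ℚ.+ seq (α i) n)) →
    ∀ j → ¬ (fromℕ b < α j)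
  large (suc m) α 0≤α integers U≃ j b<αj with i , αi≈b ← integers b ℕ.≤-refl j b<αj =
    minor-not-negative (suc b) (ι b ℚ.* c) (0<* (0<ι b) 0<c) (removeAt α i) (λ j → 0≤α (punchIn i j))
      integers′ U U≃′ rows cols rows< cols< ε 0<ε negative
    where
    integers′ : ∀ n → suc b ℕ.≤ n → ∀ j → fromℕ n < α (punchIn i j) → ∃ λ j → α (punchIn i j) ≈ fromℕ n
    integers′ n b<n j n<αj with i′ , αi′≈n ← integers n (ℕ.<⇒≤ b<n) (punchIn i j) n<αj with i Fin.≟ i′
    ... | yes refl = contradiction b<n (fromℕ-injective {α i} αi≈b αi′≈n)
    ... | no i≢i′ = punchOut i≢i′ , subst (λ i → α i ≈ fromℕ n) (sym (Fin.punchIn-punchOut i≢i′)) αi′≈n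
    αi≃b : seq (α i) ≃ λ _ → ι b
    αi≃b = ≃-cong (λ _ → refl) (λ _ → sym (ι≡n/1 b)) (mk≃ (seq-bounded (α i)) (seq-bounded (fromℕ b)) αi≈b)
    U≃′ : ∀ k → (λ n → U n k) ≃
      λ n → psumⁿ (suc b) (constant (ι b ℚ.* c)) k ℚ.* prodℚ (λ j → ι k ℚ.+ seq (α (punchIn i j)) n)
    U≃′ k = ≃-trans (U≃ k) (≃-cong
      (λ n → cong (psumⁿ b (constant c) k ℚ.*_) (sym (prodℚ-remove {i = i} (λ j → ι k ℚ.+ seq (α j) n))))
      (λ n → trans
        (solve 3 (λ x y z → x :* (y :* z) := y :* x :* z) refl (psumⁿ b (constant c) k) (ι k ℚ.+ ι b) (rest n))
        (cong (ℚ._* rest n) (θ-psumⁿ-constant b c k)))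
      (≃-* (≃-const (psumⁿ b (constant c) k)) (≃-* (≃-+ (≃-const (ι k)) αi≃b)
        (≃-prod λ j → ≃-+ (≃-const (ι k)) (≃-refl (seq-bounded (α (punchIn i j))))))))
      where
      rest : ℕ → ℚ
      rest n = prodℚ (λ j → ι k ℚ.+ seq (α (punchIn i j)) n)

theorem2 : (a : ℕ) .{{_ : NonZero a}} (m : ℕ) (α : Vector ℝ (suc m)) →
    0ℝ ≤ head α →
    α Preserves Fin._≤_ ⟶ _≤_ →
    ((n : ℕ) → a ℕ.≤ n → fromℕ n < last α → ∃ λ i → α i ≈ fromℕ n) →
    TotallyPositive (term a α)
theorem2 a m α 0≤α₀ α-mono integers d rows cols rows< cols< (ε , 0<ε , N , negative) =
  minor-not-negative a 1ℚ 0<1 α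
    (λ i → ≤-trans {0ℝ} {head α} {α i} 0≤α₀ (α-mono {zero} {i} z≤n))
    (λ n a≤n j n<αj → integers n a≤n
      (<-≤-trans {fromℕ n} {α j} {last α} n<αj (α-mono (Fin.≤fromℕ j))))
    (λ n k → seq (term a α k) n)
    (λ k → ≃-cong (λ n → sym (seq-term a α k n)) (λ _ → refl)
      (≃-* (≃-const (psumⁿ a (constant 1ℚ) k))
        (≃-prod λ i → ≃-+ (≃-const (ι k)) (≃-refl (seq-bounded (α i))))))
    rows cols rows< cols< ε 0<ε
    (N , λ n N≤n → subst (λ D → D ℚ.+ ε ℚ.≤ 0ℚ)
      (trans (seq-det (λ p q → toeplitz (term a α) (rows p) (cols q)) n)
        (det-cong λ p q → seq-toeplitz (term a α) (rows p) (cols q) n))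
      (negative n N≤n))
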